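{- The deterministic equilateral triangular tile assembly system is Turing universal at every temperature $\tau\ge 2$, in the following sense. For every integer $\tau\ge 2$ there is an algorithm that, given a deterministic Turing machine $M$ and an input word $w$, outputs a deterministic equilateral triangular tile assembly system at temperature $\tau$ such that the produce of this system is not the full plane if and only if $M$ halts on $w$.
   Context: Glues: a glue is a pair $(a,n)$ of a label $a$ and a strength $n\in\mathbb{N}=\{0,1,2,\dots\}$; there is a special non-interactive glue $\phi$. The strength function is $g((a,n),(a',n'))=n$ if $(a,n)=(a',n')$ and $0$ otherwise, and $g(\phi,\gamma)=g(\gamma,\phi)=0$ for every glue $\gamma$. Equilateral triangular tile: an equilateral triangle of side length $1$ with a glue on each side, written $(\gamma_1,\gamma_2,\gamma_3,k)$ with $k\in\{\mathtt{u},\mathtt{d}\}$. For $k=\mathtt{u}$ the horizontal side is at the bottom (upward position), for $k=\mathtt{d}$ it is at the top (downward position); $\gamma_1,\gamma_2,\gamma_3$ are the glues on the sides in counter-clockwise order starting from the horizontal side. Tiles may be translated, but not rotated or flipped. A super-tile is a set of placed (translated) tiles with pairwise disjoint interiors such that any two of them are joined by a path of tiles in which consecutive tiles share a common side with positive strength. A tile can stick to a super-tile at temperature $\tau$ if it can be placed, without overlapping the super-tile, so that the sum of $g(\gamma_i,\gamma_i')$ over all sides it shares (coinciding sides of equal length) with tiles of the super-tile is at least $\tau$. A tile assembly system is a tuple $(T,s,g,\tau)$ with $T$ a finite set of tiles (each available in unlimited supply), seed $s\in T$, strength function $g$ and temperature $\tau$. A produce is obtained from the seed by sticking one tile of $T$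 at a time until no tile of $T$ can stick any more; when growth does not terminate, the produce is the union of an infinite sequence of such single-tile attachments to which no tile of $T$ can stick any more. The system is deterministic if its produce is unique regardless of the choices made at each step. The produce is the full plane if its tiles cover the whole plane and every two tiles sharing a side have positive strength on that common side. Turing machines are deterministic, with a two-way infinite tape that is blank outside the input; $M$ halts on $w$ if it reaches a configuration for which the transition function is undefined. -}

module Defs where

open import Data.Bool using (if_then_else_)
open import Data.Fin using (Fin)
open import Data.Fin.Patterns using (0F; 1F; 2F)
open import Data.Integer as ℤ using (ℤ; +_; -[1+_]; 0ℤ)
open import Data.Integer.Properties using (suc-pred)
open import Data.List using (List; []; _∷_; [_])
open import Data.List.Membership.Propositional using (_∈_)
open import Data.List.Properties using (≡-dec)
open import Data.Maybe using (Maybe; just; nothing)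
open import Data.Nat as ℕ using (ℕ; zero; suc; _+_; _≤_; _<_)
open import Data.Product using (∃; ∃!; ∃-syntax; Σ-syntax; _×_; _,_; swap)
open import Data.Vec using (Vec; lookup)
open import Level using (0ℓ)
open import Relation.Binary.Construct.Closure.ReflexiveTransitive using (Star)
open import Relation.Binary.PropositionalEquality
  using (_≡_; _≢_; refl; cong)
open import Relation.Nullary using (¬_)
open import Relation.Nullary.Decidable using (⌊_⌋; _×-dec_)
open import Relation.Unary using (Pred; _≐_)

-- Labels are words over a countable alphabet, so that any finite set of
-- labels can be named.
Label : Set
Label = List ℕ

data Glue : Set where
  φ    : Glue
  glue : (a : Label) (n : ℕ) → Glue

strength : Glue → Glue → ℕ
strength φ          _          = 0
strength (glue _ _) φ          = 0
strength (glue a m) (glue b n) =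
  if ⌊ ≡-dec ℕ._≟_ a b ×-dec (m ℕ.≟ n) ⌋ then m else 0

data Orientation : Set where
  up down : Orientation

-- Sides are numbered counter-clockwise, starting from the horizontal one.
Side : Set
Side = Fin 3

record Tile : Set where
  constructor mkTile
  field
    glues       : Vec Glue 3
    orientation : Orientation

open Tile public

glueOn : Tile → Side → Glue
glueOn t = lookup (glues t)

-- (x , y) is the point x·(1 , 0) + y·(1/2 , √3/2) of the plane.
Point : Set
Point = ℤ × ℤ

origin : Point
origin = 0ℤ , 0ℤ

-- At a positive temperature a tile only ever sticks along a common unit
-- side, so all tiles of a growing super-tile are cells of the triangular
-- lattice through the seed.  The up cell at (x , y) has vertices
-- (x , y), (x+1 , y), (x , y+1); the down cell at (x , y) has vertices
-- (x+1 , y+1), (x , y+1), (x+1 , y).  Two tiles overlap exactly when their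
-- cells are equal.
Cell : Set
Cell = Point × Orientation

-- End points of a side, traversed counter-clockwise around the cell.
edge : Cell → Side → Point × Point
edge ((x , y) , up)   0F = (x , y)             , (ℤ.suc x , y)
edge ((x , y) , up)   1F = (ℤ.suc x , y)       , (x , ℤ.suc y)
edge ((x , y) , up)   2F = (x , ℤ.suc y)       , (x , y)
edge ((x , y) , down) 0F = (ℤ.suc x , ℤ.suc y) , (x , ℤ.suc y)
edge ((x , y) , down) 1F = (x , ℤ.suc y)       , (ℤ.suc x , y)
edge ((x , y) , down) 2F = (ℤ.suc x , y)       , (ℤ.suc x , ℤ.suc y)

-- The cell on the other side of a given side.
neighbour : Cell → Side → Cell
neighbour ((x , y) , up)   0F = (x , ℤ.pred y) , down
neighbour ((x , y) , up)   1F = (x , y)        , down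
neighbour ((x , y) , up)   2F = (ℤ.pred x , y) , down
neighbour ((x , y) , down) 0F = (x , ℤ.suc y)  , up
neighbour ((x , y) , down) 1F = (x , y)        , up
neighbour ((x , y) , down) 2F = (ℤ.suc x , y)  , up

-- Side k of a cell is also side k of its neighbour (and is traversed in the
-- opposite direction there).
edge-neighbour : ∀ c k → edge (neighbour c k) k ≡ swap (edge c k)
edge-neighbour ((x , y) , up)   0F = cong (λ z → (ℤ.suc x , z) , (x , z)) (suc-pred y)
edge-neighbour ((x , y) , up)   1F = refl
edge-neighbour ((x , y) , up)   2F = cong (λ z → (z , y) , (z , ℤ.suc y)) (suc-pred x)
edge-neighbour ((x , y) , down) 0F = refl
edge-neighbour ((x , y) , down) 1F = refl
edge-neighbour ((x , y) , down) 2F = refl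

record PlacedTile : Set where
  constructor _at_
  field
    tile     : Tile
    position : Point

open PlacedTile public

cell : PlacedTile → Cell
cell p = position p , orientation (tile p)

Assembly : Set₁
Assembly = Pred PlacedTile 0ℓ

-- Bond A p k n: side k of p contributes strength n against the tiles of A.
data Bond (A : Assembly) (p : PlacedTile) (k : Side) : ℕ → Set where
  shared   : ∀ {q} → A q → cell q ≡ neighbour (cell p) k →
             Bond A p k (strength (glueOn (tile p) k) (glueOn (tile q) k))
  unshared : (∀ {q} → A q → cell q ≢ neighbour (cell p) k) → Bond A p k 0

-- The strength function is the fixed function `strength` above.
record TileSystem (τ : ℕ) : Set where
  field
    tiles      : List Tile
    seed       : Tile
    seed∈tiles : seed ∈ tiles

module _ {τ : ℕ} (S : TileSystem τ) where
  open TileSystem S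

  CanStick : Assembly → PlacedTile → Set
  CanStick A p =
      tile p ∈ tiles
    × (∀ {q} → A q → cell q ≢ cell p)
    × Σ[ b ∈ (Side → ℕ) ] ((∀ k → Bond A p k (b k)) × τ ≤ b 0F + b 1F + b 2F)

  Terminal : Assembly → Set
  Terminal A = ¬ ∃ (CanStick A)

  -- Finite super-tiles are lists of placed tiles.
  start : List PlacedTile
  start = [ seed at origin ]

  data Step (A : List PlacedTile) : List PlacedTile → Set where
    stick : ∀ {p} → CanStick (_∈ A) p → Step A (p ∷ A)

  data Produce (P : Assembly) : Set where
    finite   : ∀ {A} → Star Step start A →
               P ≐ (_∈ A) → Terminal P → Produce P
    infinite : (s : ℕ → List PlacedTile) →
               s 0 ≡ start → (∀ n → Step (s n) (s (suc n))) →
               P ≐ (λ p → ∃[ n ] (p ∈ s n)) → Terminal P → Produce P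

  Deterministic : Set₁
  Deterministic = ∃! _≐_ Produce

FullPlane : Assembly → Set
FullPlane P =
    (∀ c → ∃[ p ] (P p × cell p ≡ c))
  × (∀ {p q} → P p → P q → ∀ k → cell q ≡ neighbour (cell p) k →
       0 < strength (glueOn (tile p) k) (glueOn (tile q) k))

data Direction : Set where
  left right : Direction

record TuringMachine : Set where
  field
    states  : ℕ
    symbols : ℕ
    initial : Fin states
    blank   : Fin symbols
    δ       : Fin states → Fin symbols →
              Maybe (Fin states × Fin symbols × Direction)

module _ (M : TuringMachine) where
  open TuringMachine M

  -- Input words are arbitrary words over the tape alphabet; the words over
  -- any chosen input alphabet are among them.
  Word : Set
  Word = List (Fin symbols)

  record Configuration : Set where
    constructor ⟨_,_,_⟩
    field
      state : Fin states
      head  : ℤ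
      tape  : ℤ → Fin symbols

  open Configuration

  inputTape : Word → ℤ → Fin symbols
  inputTape []      _           = blank
  inputTape (a ∷ w) (+ zero)    = a
  inputTape (a ∷ w) (+ (suc n)) = inputTape w (+ n)
  inputTape (a ∷ w) -[1+ n ]    = blank

  initialConfiguration : Word → Configuration
  initialConfiguration w = ⟨ initial , 0ℤ , inputTape w ⟩

  move : Direction → ℤ → ℤ
  move left  = ℤ.pred
  move right = ℤ.suc

  write : ℤ → Fin symbols → (ℤ → Fin symbols) → ℤ → Fin symbols
  write i a t j = if ⌊ j ℤ.≟ i ⌋ then a else t j

  action : Configuration → Maybe (Fin states × Fin symbols × Direction)
  action c = δ (state c) (tape c (head c))

  data _⟶_ (c : Configuration) : Configuration → Set where
    step : ∀ {q a d} → action c ≡ just (q , a , d) →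
           c ⟶ ⟨ q , move d (head c) , write (head c) a (tape c) ⟩

  Halts : Word → Set
  Halts w = ∃[ c ] (Star _⟶_ (initialConfiguration w) c × action c ≡ nothing)

{-# OPTIONS --safe #-}
module Submission where

-- Cut the plane into rhombi, each made of the up and the down cell at a point
-- (x , y), and let x + y be time.  An up tile at positive time needs its sides 0
-- and 2, of strengths 1 and τ − 1, and passes the pair of labels read there
-- through side 1 with strength τ; the down tile applies a function to the pair
-- and sends the results out through its sides 0 and 2.  This is a brick-wall
-- cellular automaton whose labels are tape cells, one of them carrying the head.
-- Its initial row is spelled by a strip of strength-τ bonds growing both ways from
-- the seed, and two filler tiles tile the past.  Every tile is thus forced by the
-- tiles at its input sides, which makes growth deterministic, and the only missing
-- tiles are those for a pair whose head has no transition.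

open import Defs
open import Axiom.ExcludedMiddle using (ExcludedMiddle)
open import Data.Bool using (Bool; true; false; if_then_else_)
open import Data.Empty using (⊥-elim)
open import Data.Fin as Fin using (Fin; toℕ; fromℕ<)
open import Data.Fin.Patterns using (0F; 1F; 2F)
open import Data.Fin.Properties using (pigeonhole; fromℕ<-injective; toℕ-injective)
open import Data.Integer as ℤ using (ℤ; +_; -[1+_]; 0ℤ)
import Data.Integer.Properties as ℤ
open import Data.List
  using (List; []; _∷_; map; _++_; drop; tails; allFin; cartesianProduct; cartesianProductWith)
open import Data.List.Membership.Propositional using (_∈_)
open import Data.List.Membership.Propositional.Properties
  using (∈-map⁺; ∈-map⁻; ∈-++⁺ˡ; ∈-++⁺ʳ; ∈-++⁻; ∈-allFin; ∈-cartesianProduct⁺;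
         ∈-cartesianProductWith⁺; ∈-cartesianProductWith⁻)
open import Data.List.Properties using (≡-dec; ∷-injective; drop-drop)
open import Data.List.Relation.Unary.Any using (here; there)
open import Data.Maybe using (Maybe; just; nothing)
open import Data.Nat
open import Data.Nat.Induction using (<-wellFounded)
open import Data.Nat.Properties
open import Data.Product using (Σ-syntax; ∃; ∃-syntax; _×_; _,_; proj₁; proj₂)
open import Data.Sum using (_⊎_; inj₁; inj₂)
open import Data.Vec using (_∷_; [])
open import Function using (id; _∘_)
open import Function.Bundles using (_⇔_; mk⇔)
open import Induction.WellFounded using (Acc; acc)
open import Level using (0ℓ)
open import Relation.Binary.Construct.Closure.ReflexiveTransitive using (Star; ε; _◅_; _◅◅_)
open import Relation.Binary.Definitions using (tri<; tri≈; tri>)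
open import Relation.Binary.PropositionalEquality
open import Relation.Nullary using (¬_; yes; no; contradiction; does)
open import Relation.Nullary.Decidable using (_×-dec_)
open import Relation.Unary using (_⊆_)

-- The obstacle is that glues have no direction: a bond meant as an output could equally attract a
-- tile from the wrong side, and growth could creep backwards around a hole. Each side is therefore
-- declared an input of one of its two cells, in such a way that the inputs of every cell except the
-- seed's sum to exactly τ. An attaching tile then needs all its inputs at once, and an output side
-- cannot help, since the neighbour across it would itself have needed this cell first. The
-- strengths 1 and τ - 1 are both positive and add up to τ, which is where τ ≥ 2 enters. Produced
-- tiles are compared with a labelling of the whole plane. It is defined even at cells that a
-- halting machine leaves empty, because the simulated run stands still after halting. A produce
-- must be terminal, so an infinite growth has to be fair; this is why the cells are numbered.

strength-self : ∀ a n → strength (glue a n) (glue a n) ≡ n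
strength-self a n with ≡-dec _≟_ a a ×-dec (n ≟ n)
... | yes _ = refl
... | no ¬p = contradiction (refl , refl) ¬p

strength-≤ : ∀ g h → strength g h ≤ strength h h
strength-≤ φ          h = z≤n
strength-≤ (glue a m) φ = z≤n
strength-≤ (glue a m) (glue b n) with ≡-dec _≟_ a b ×-dec (m ≟ n)
... | yes (_ , refl) = ≤-reflexive (sym (strength-self b n))
... | no _           = z≤n

strength-match : ∀ g h → 0 < strength g h → g ≡ h
strength-match (glue a m) (glue b n) 0<s with ≡-dec _≟_ a b ×-dec (m ≟ n) | 0<s
... | yes (refl , refl) | _ = refl
... | no _              | ()

neighbour-involutive : ∀ c k → neighbour (neighbour c k) k ≡ c
neighbour-involutive ((x , y) , up)   0F = cong (λ z → (x , z) , up) (ℤ.suc-pred y)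
neighbour-involutive ((x , y) , up)   1F = refl
neighbour-involutive ((x , y) , up)   2F = cong (λ z → (z , y) , up) (ℤ.suc-pred x)
neighbour-involutive ((x , y) , down) 0F = cong (λ z → (x , z) , down) (ℤ.pred-suc y)
neighbour-involutive ((x , y) , down) 1F = refl
neighbour-involutive ((x , y) , down) 2F = cong (λ z → (z , y) , down) (ℤ.pred-suc x)

-- An injective numbering of the cells

pairCode : ℕ → ℕ → ℕ
pairCode a b = (a + b) * (a + b) + a

-- s * s ≤ pairCode a b < suc s * suc s for s = a + b, so the code determines s.
pairCode-sum : ∀ a b c d → a + b < c + d → pairCode a b < pairCode c d
pairCode-sum a b c d lt = begin-strict
  s * s + a          ≤⟨ +-monoʳ-≤ (s * s) (m≤m+n a b) ⟩
  s * s + s          ≡⟨ +-comm (s * s) s ⟩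
  suc s * s          <⟨ *-monoʳ-< (suc s) (n<1+n s) ⟩
  suc s * suc s      ≤⟨ *-mono-≤ lt lt ⟩
  (c + d) * (c + d)  ≤⟨ m≤m+n _ c ⟩
  pairCode c d       ∎
  where
  open ≤-Reasoning
  s = a + b

pairCode-injective : ∀ a b c d → pairCode a b ≡ pairCode c d → a ≡ c × b ≡ d
pairCode-injective a b c d eq with <-cmp (a + b) (c + d)
... | tri< lt _ _ = contradiction eq (<⇒≢ (pairCode-sum a b c d lt))
... | tri> _ _ gt = contradiction (sym eq) (<⇒≢ (pairCode-sum c d a b gt))
... | tri≈ _ s≡ _ = a≡c , +-cancelˡ-≡ a b d (trans s≡ (cong (_+ d) (sym a≡c)))
  where
  a≡c : a ≡ c
  a≡c = +-cancelˡ-≡ ((a + b) * (a + b)) a c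
          (trans eq (cong (λ s → s * s + c) (sym s≡)))

integerCode : ℤ → ℕ
integerCode (+ n)    = pairCode 0 n
integerCode -[1+ n ] = pairCode 1 n

integerCode-injective : ∀ i j → integerCode i ≡ integerCode j → i ≡ j
integerCode-injective (+ m)    (+ n)    eq = cong +_ (proj₂ (pairCode-injective 0 m 0 n eq))
integerCode-injective (+ m)    -[1+ n ] eq with () ← proj₁ (pairCode-injective 0 m 1 n eq)
integerCode-injective -[1+ m ] (+ n)    eq with () ← proj₁ (pairCode-injective 1 m 0 n eq)
integerCode-injective -[1+ m ] -[1+ n ] eq = cong -[1+_] (proj₂ (pairCode-injective 1 m 1 n eq))

orientationCode : Orientation → ℕ
orientationCode up   = 0
orientationCode down = 1

orientationCode-injective : ∀ o o′ → orientationCode o ≡ orientationCode o′ → o ≡ o′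
orientationCode-injective up   up   _ = refl
orientationCode-injective down down _ = refl

cellCode : Cell → ℕ
cellCode ((x , y) , o) =
  pairCode (pairCode (integerCode x) (integerCode y)) (orientationCode o)

cellCode-injective : ∀ c d → cellCode c ≡ cellCode d → c ≡ d
cellCode-injective ((x , y) , o) ((x′ , y′) , o′) eq =
  let xy≡ , o≡ = pairCode-injective _ _ _ _ eq
      x≡  , y≡ = pairCode-injective _ _ _ _ xy≡
  in cong₂ _,_ (cong₂ _,_ (integerCode-injective x x′ x≡) (integerCode-injective y y′ y≡))
               (orientationCode-injective o o′ o≡)

-- Existence of a produce by fair growth

Occupied : Assembly → Cell → Set
Occupied A c = ∃[ q ] (A q × cell q ≡ c)

module Existence
  (em : ExcludedMiddle 0ℓ) {τ : ℕ} (S : TileSystem τ)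
  (code : Cell → ℕ) (code-injective : ∀ c d → code c ≡ code d → c ≡ d) where
  open TileSystem S

  least : {Q : ℕ → Set} → ∃ Q → ∃[ n ] (Q n × (∀ {m} → Q m → n ≤ m))
  least {Q} (n , qn) = go n (<-wellFounded n) qn
    where
    go : ∀ n → Acc _<_ n → Q n → ∃[ n ] (Q n × (∀ {m} → Q m → n ≤ m))
    go n (acc rs) qn with em {∃[ m ] (m < n × Q m)}
    ... | yes (m , m<n , qm) = go m (rs m<n) qm
    ... | no none            = n , qn , λ {m} qm → ≮⇒≥ (λ m<n → none (m , m<n , qm))

  -- Growth always continues at the free cell of least code, which makes it fair.
  data Advance (A : List PlacedTile) : List PlacedTile → Set where
    stay : Terminal S (_∈ A) → Advance A A
    grow : ∀ {p} → CanStick S (_∈ A) p →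
           (∀ {q} → CanStick S (_∈ A) q → code (cell p) ≤ code (cell q)) →
           Advance A (p ∷ A)

  advance : ∀ A → ∃ (Advance A)
  advance A with em {∃ (CanStick S (_∈ A))}
  ... | no none         = A , stay none
  ... | yes (p , can)
    with least {λ n → ∃[ q ] (CanStick S (_∈ A) q × code (cell q) ≡ n)}
               (_ , p , can , refl)
  ... | _ , (q , canq , refl) , minimal = q ∷ A , grow canq (λ can′ → minimal (_ , can′ , refl))

  stage : ℕ → List PlacedTile
  stage zero    = start S
  stage (suc n) = proj₁ (advance (stage n))

  advance-star : ∀ {A B} → Advance A B → Star (Step S) A B
  advance-star (stay _)     = ε
  advance-star (grow can _) = stick can ◅ ε

  stage-star : ∀ n → Star (Step S) (start S) (stage n)
  stage-star zero    = ε
  stage-star (suc n) = stage-star n ◅◅ advance-star (proj₂ (advance (stage n)))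

  advance-⊆ : ∀ {A B p} → Advance A B → p ∈ A → p ∈ B
  advance-⊆ (stay _)   p∈A = p∈A
  advance-⊆ (grow _ _) p∈A = there p∈A

  stage-mono : ∀ {m n p} → m ≤ n → p ∈ stage m → p ∈ stage n
  stage-mono {m} {n} m≤n p∈ with ≤⇒≤′ m≤n
  ... | ≤′-refl                = p∈
  ... | ≤′-step {n = n′} m≤′n′ =
    advance-⊆ (proj₂ (advance (stage n′))) (stage-mono (≤′⇒≤ m≤′n′) p∈)

  module Endless (endless : ¬ (∃[ n ] Terminal S (_∈ stage n))) where

    Limit : Assembly
    Limit p = ∃[ n ] (p ∈ stage n)

    advance-step : ∀ n {B} → Advance (stage n) B → Step S (stage n) B
    advance-step n (stay t)     = contradiction (n , t) endless
    advance-step n (grow can _) = stick can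

    bond-persists : ∀ {p k b} → Bond Limit p k b →
                    ∃[ N ] (∀ {n} → N ≤ n → Bond (_∈ stage n) p k b)
    bond-persists (shared (N , q∈) eq) = N , λ N≤n → shared (stage-mono N≤n q∈) eq
    bond-persists (unshared free)      = 0 , λ {n} _ → unshared (λ q∈ → free (n , q∈))

    -- Free cells and absent neighbours pass from the limit to every stage. Each neighbour that is
    -- present appears at some finite stage, and the sum of the three stages bounds all of them.
    stick-persists : ∀ {p} → CanStick S Limit p →
                     ∃[ N ] (∀ {n} → N ≤ n → CanStick S (_∈ stage n) p)
    stick-persists (t∈ , free , b , bonds , enough) =
      let N₀ , bond₀ = bond-persists (bonds 0F)
          N₁ , bond₁ = bond-persists (bonds 1F)
          N₂ , bond₂ = bond-persists (bonds 2F)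
      in N₀ + N₁ + N₂ , λ {n} N≤n → t∈ , (λ q∈ → free (n , q∈)) , b
         , (λ { 0F → bond₀ (≤-trans (≤-trans (m≤m+n N₀ N₁) (m≤m+n (N₀ + N₁) N₂)) N≤n)
              ; 1F → bond₁ (≤-trans (≤-trans (m≤n+m N₁ N₀) (m≤m+n (N₀ + N₁) N₂)) N≤n)
              ; 2F → bond₂ (≤-trans (m≤n+m N₂ (N₀ + N₁)) N≤n) })
         , enough

    Added : ℕ → ℕ → Set
    Added m n = ∃[ q ] (CanStick S (_∈ stage n) q × q ∈ stage (suc n) × code (cell q) ≤ m)

    added : ∀ {p} n → CanStick S (_∈ stage n) p → Added (code (cell p)) n
    added {p} n can = from (proj₂ (advance (stage n)))
      where
      from : ∀ {B} → Advance (stage n) B →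
             ∃[ q ] (CanStick S (_∈ stage n) q × q ∈ B × code (cell q) ≤ code (cell p))
      from (stay t)           = contradiction (_ , can) t
      from (grow canq minimal) = _ , canq , here refl , minimal can

    -- A tile that could stick to the limit could stick to all late stages, so these
    -- would fill infinitely many cells of bounded code.
    limit-terminal : Terminal S Limit
    limit-terminal (p , can) =
      let i , j , i<j , eq = pigeonhole (n<1+n _) slot
          i≢j = λ e → proj₁ (proj₂ (proj₁ (proj₂ (new (toℕ j))))) (later i j i<j) e
      in i≢j (code-injective _ _ (fromℕ<-injective _ _ (bounded i) (bounded j) eq))
      where
      N = proj₁ (stick-persists can)
      new : ∀ i → Added (code (cell p)) (N + i)
      new i = added (N + i) (proj₂ (stick-persists can) (m≤m+n N i))
      bounded : (i : Fin (suc (suc (code (cell p))))) →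
                code (cell (proj₁ (new (toℕ i)))) < suc (code (cell p))
      bounded i = s≤s (proj₂ (proj₂ (proj₂ (new (toℕ i)))))
      slot : Fin (suc (suc (code (cell p)))) → Fin (suc (code (cell p)))
      slot i = fromℕ< (bounded i)
      later : ∀ i j → i Fin.< j → proj₁ (new (toℕ i)) ∈ stage (N + toℕ j)
      later i j i<j = stage-mono
        (subst (_≤ N + toℕ j) (+-suc N (toℕ i)) (+-monoʳ-≤ N i<j))
        (proj₁ (proj₂ (proj₂ (new (toℕ i)))))

  produce : ∃ (Produce S)
  produce with em {∃[ n ] Terminal S (_∈ stage n)}
  ... | yes (n , t) = _ , finite (stage-star n) (id , id) t
  ... | no endless  = _ , infinite stage refl
                            (λ n → Endless.advance-step endless n (proj₂ (advance (stage n))))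
                            (id , id) (Endless.limit-terminal endless)

-- Facts common to finite and infinite produces

module _ {τ : ℕ} {S : TileSystem τ} where

  step-⊆ : ∀ {A B p} → Star (Step S) A B → p ∈ A → p ∈ B
  step-⊆ ε               p∈ = p∈
  step-⊆ (stick _ ◅ st)  p∈ = step-⊆ st (there p∈)

  produce-terminal : ∀ {P} → Produce S P → Terminal S P
  produce-terminal (finite _ _ t)       = t
  produce-terminal (infinite _ _ _ _ t) = t

  produce-seed : ∀ {P} → Produce S P → P (TileSystem.seed S at origin)
  produce-seed (finite st (_ , ⊇) _)       = ⊇ (step-⊆ st (here refl))
  produce-seed (infinite s e _ (_ , ⊇) _)  = ⊇ (0 , subst (_ ∈_) (sym e) (here refl))

  -- Reduces statements about the members of either kind of produce to induction along a finite
  -- growth sequence.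
  produce-stage : ∀ {P p} → Produce S P → P p → ∃[ A ] (Star (Step S) (start S) A × p ∈ A)
  produce-stage (finite st (⊆ , _) _) Pp = _ , st , ⊆ Pp
  produce-stage (infinite s e steps (⊆ , _) _) Pp = let n , p∈ = ⊆ Pp in s n , star n , p∈
    where
    star : ∀ n → Star (Step S) (start S) (s n)
    star zero    = subst (Star (Step S) (start S)) (sym e) ε
    star (suc n) = star n ◅◅ (steps n ◅ ε)

-- Local determinism and uniqueness of the produce

module LocalDeterminism
  {τ : ℕ} (S : TileSystem τ) (ideal : Cell → Side → Glue) (input : Cell → Side → Bool) where
  open TileSystem S

  source : Cell
  source = cell (seed at origin)

  weight : Cell → Side → ℕ
  weight c k = if input c k then strength (ideal c k) (ideal c k) else 0

  -- A form of Soloveichik and Winfree's local determinism, relative to a labelling of all sides of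
  -- the lattice rather than to an assembly. The equality in `input-weight` works in both
  -- directions: at least τ lets the ideal tile attach once its inputs are present, and at most τ
  -- prevents attachment while one is missing.
  record LocallyDeterministic : Set where
    field
      ideal-neighbour : ∀ c k → ideal (neighbour c k) k ≡ ideal c k
      ideal-positive  : ∀ c k → 0 < strength (ideal c k) (ideal c k)
      ideal-seed      : ∀ k → glueOn seed k ≡ ideal source k
      flow            : ∀ c k → input c k ≡ false → input (neighbour c k) k ≡ true
      source-input    : ∀ k → input source k ≡ false
      input-weight    : ∀ c → c ≢ source → weight c 0F + weight c 1F + weight c 2F ≡ τ
      input-unique    : ∀ {t} c → t ∈ tiles → orientation t ≡ proj₂ c → c ≢ source →
                        (∀ k → input c k ≡ true → glueOn t k ≡ ideal c k) →
                        ∀ k → glueOn t k ≡ ideal c k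

  module Properties (ld : LocallyDeterministic) where
    open LocallyDeterministic ld

    Ideal : PlacedTile → Set
    Ideal p = ∀ k → glueOn (tile p) k ≡ ideal (cell p) k

    ideal-unique : ∀ {p q} → Ideal p → Ideal q → cell p ≡ cell q → p ≡ q
    ideal-unique {mkTile (_ ∷ _ ∷ _ ∷ []) _ at _} {mkTile (_ ∷ _ ∷ _ ∷ []) _ at _} ip iq refl
      with refl ← trans (ip 0F) (sym (iq 0F))
         | refl ← trans (ip 1F) (sym (iq 1F))
         | refl ← trans (ip 2F) (sym (iq 2F)) = refl

    -- Every tile was placed after the tiles at its input sides.  Hence a new tile
    -- can only bond at its input sides, whose total weight τ it needs in full.
    record Sound (A : Assembly) : Set where
      field
        sound-seed  : A (seed at origin)
        sound-tile  : ∀ {q} → A q → tile q ∈ tiles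
        sound-ideal : ∀ {q} → A q → Ideal q
        sound-input : ∀ {q} → A q → ∀ k → input (cell q) k ≡ true →
                      Occupied A (neighbour (cell q) k)

    open Sound public

    start-sound : Sound (_∈ start S)
    start-sound = record
      { sound-seed  = here refl
      ; sound-tile  = λ { (here refl) → seed∈tiles }
      ; sound-ideal = λ { (here refl) → ideal-seed }
      ; sound-input = λ { (here refl) k i → contradiction (trans (sym i) (source-input k)) λ () } }

    module _ {A : Assembly} (sound : Sound A) {p : PlacedTile}
             (free : ∀ {q} → A q → cell q ≢ cell p) where

      bond-≤ : ∀ {k n} → Bond A p k n → n ≤ weight (cell p) k
      bond-≤ {k} b with input (cell p) k in eq
      bond-≤ {k} (unshared _) | true = z≤n
      bond-≤ {k} (shared {q} Aq e) | true = begin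
        strength (glueOn (tile p) k) (glueOn (tile q) k) ≤⟨ strength-≤ (glueOn (tile p) k) _ ⟩
        strength (glueOn (tile q) k) (glueOn (tile q) k)
          ≡⟨ cong (λ g → strength g g) (trans (sound-ideal sound Aq k)
               (trans (cong (λ c → ideal c k) e) (ideal-neighbour (cell p) k))) ⟩
        strength (ideal (cell p) k) (ideal (cell p) k) ∎
        where open ≤-Reasoning
      bond-≤ {k} (unshared _) | false = z≤n
      -- By `flow` the shared side is an input of `q`, so `q` could only be placed once the cell of
      -- `p` was occupied, against `free`.
      bond-≤ {k} (shared {q} Aq e) | false =
        let r , Ar , er = sound-input sound Aq k
                            (trans (cong (λ c → input c k) e) (flow (cell p) k eq))
        in contradiction
             (trans er (trans (cong (λ c → neighbour c k) e) (neighbour-involutive (cell p) k)))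
             (free Ar)

      positive-bond : ∀ {k n} → Bond A p k n → 0 < n →
        Occupied A (neighbour (cell p) k) × glueOn (tile p) k ≡ ideal (cell p) k
      positive-bond {k} (shared {q} Aq e) 0<n = (q , Aq , e) ,
        trans (strength-match _ _ 0<n) (trans (sound-ideal sound Aq k)
          (trans (cong (λ c → ideal c k) e) (ideal-neighbour (cell p) k)))

    squeeze : ∀ {a b c x y z} → a ≤ x → b ≤ y → c ≤ z → x + y + z ≤ a + b + c →
              a ≡ x × b ≡ y × c ≡ z
    squeeze {a} {b} {c} {x} {y} {z} a≤x b≤y c≤z le =
      ≤-antisym a≤x x≤a , ≤-antisym b≤y y≤b , ≤-antisym c≤z z≤c
      where
      z≤c : z ≤ c
      z≤c = +-cancelˡ-≤ (x + y) z c (≤-trans le (+-monoˡ-≤ c (+-mono-≤ a≤x b≤y)))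
      xy≤ab : x + y ≤ a + b
      xy≤ab = +-cancelʳ-≤ z (x + y) (a + b) (≤-trans le (+-monoʳ-≤ (a + b) c≤z))
      y≤b : y ≤ b
      y≤b = +-cancelˡ-≤ x y b (≤-trans xy≤ab (+-monoˡ-≤ b a≤x))
      x≤a : x ≤ a
      x≤a = +-cancelʳ-≤ y x a (≤-trans xy≤ab (+-monoʳ-≤ a b≤y))

    weight-positive : ∀ c k → input c k ≡ true → 0 < weight c k
    weight-positive c k i rewrite i = ideal-positive c k

    stick-input : ∀ {A p} → Sound A → CanStick S A p → ∀ k → input (cell p) k ≡ true →
      Occupied A (neighbour (cell p) k) × glueOn (tile p) k ≡ ideal (cell p) k
    stick-input {A} {p} sound (_ , free , b , bonds , enough) k i =
      positive-bond sound free (bonds k)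
        (subst (0 <_) (sym (full k)) (weight-positive (cell p) k i))
      where
      squeezed = squeeze (bond-≤ sound free (bonds 0F)) (bond-≤ sound free (bonds 1F))
        (bond-≤ sound free (bonds 2F))
        (≤-trans (≤-reflexive (input-weight (cell p)
          (λ e → free (sound-seed sound) (sym e)))) enough)
      full : ∀ k → b k ≡ weight (cell p) k
      full 0F = proj₁ squeezed
      full 1F = proj₁ (proj₂ squeezed)
      full 2F = proj₂ (proj₂ squeezed)

    stick-ideal : ∀ {A p} → Sound A → CanStick S A p → Ideal p
    stick-ideal {p = p} sound can@(t∈ , free , _) =
      input-unique (cell p) t∈ refl (λ e → free (sound-seed sound) (sym e))
        (λ k i → proj₂ (stick-input sound can k i))

    step-sound : ∀ {A B} → Step S A B → Sound (_∈ A) → Sound (_∈ B)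
    step-sound {A} (stick {p} can) sound = record
      { sound-seed  = there (sound-seed sound)
      ; sound-tile  = λ { (here refl) → proj₁ can ; (there q∈) → sound-tile sound q∈ }
      ; sound-ideal = λ { (here refl) → stick-ideal sound can ; (there q∈) → sound-ideal sound q∈ }
      ; sound-input = λ { (here refl) k i → weaken (proj₁ (stick-input sound can k i))
                        ; (there q∈) k i → weaken (sound-input sound q∈ k i) } }
      where
      weaken : ∀ {c} → Occupied (_∈ A) c → Occupied (_∈ (p ∷ A)) c
      weaken (q , q∈ , e) = q , there q∈ , e

    star-sound : ∀ {A B} → Star (Step S) A B → Sound (_∈ A) → Sound (_∈ B)
    star-sound ε         = id
    star-sound (st ◅ sts) = star-sound sts ∘ step-sound st

    produce-ideal : ∀ {P p} → Produce S P → P p → Ideal p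
    produce-ideal prod Pp = let _ , st , p∈ = produce-stage prod Pp in
      sound-ideal (star-sound st start-sound) p∈

    produce-tile : ∀ {P p} → Produce S P → P p → tile p ∈ tiles
    produce-tile prod Pp = let _ , st , p∈ = produce-stage prod Pp in
      sound-tile (star-sound st start-sound) p∈

    produce-bond : ∀ {P} → Produce S P → ∀ {p q} → P p → P q → ∀ k → cell q ≡ neighbour (cell p) k →
                   0 < strength (glueOn (tile p) k) (glueOn (tile q) k)
    produce-bond prod {p} {q} Pp Pq k e
      rewrite produce-ideal prod Pp k | produce-ideal prod Pq k | e | ideal-neighbour (cell p) k
      = ideal-positive (cell p) k

    module _ (em : ExcludedMiddle 0ℓ) where

      bond : ∀ A p k → ∃ (Bond A p k)
      bond A p k with em {Occupied A (neighbour (cell p) k)}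
      ... | yes (_ , Aq , e) = _ , shared Aq e
      ... | no none          = _ , unshared (λ Aq e → none (_ , Aq , e))

      bond-grows : ∀ {A P p k n} → A ⊆ P → Bond A p k n → ∃[ m ] (Bond P p k m × n ≤ m)
      bond-grows A⊆P (shared Aq e) = _ , shared (A⊆P Aq) e , ≤-refl
      bond-grows {P = P} {p} {k} A⊆P (unshared _) = let m , b = bond P p k in m , b , z≤n

      -- If the cell of `p` is occupied in `P`, its occupant and `p` are both ideal and hence equal.
      -- If it is free, `p` still sticks to the larger assembly `P`, because bonds only grow, and
      -- this contradicts terminality.
      absorb : ∀ {A P} → Produce S P → Sound A → A ⊆ P → ∀ {p} → CanStick S A p → P p
      absorb {A} {P} prod sound A⊆P {p} can@(t∈ , _ , b , bonds , enough)
        with em {Occupied P (cell p)}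
      ... | yes (q , Pq , e) =
        subst P (ideal-unique (produce-ideal prod Pq) (stick-ideal sound can) e) Pq
      ... | no none = ⊥-elim (produce-terminal prod
        (p , t∈ , (λ Pq e → none (_ , Pq , e)) , (λ k → proj₁ (grown k))
           , (λ k → proj₁ (proj₂ (grown k)))
           , ≤-trans enough (+-mono-≤ (+-mono-≤ (proj₂ (proj₂ (grown 0F))) (proj₂ (proj₂ (grown 1F))))
                                      (proj₂ (proj₂ (grown 2F))))))
        where
        grown : ∀ k → ∃[ m ] (Bond P p k m × b k ≤ m)
        grown k = bond-grows A⊆P (bonds k)

      star-⊆ : ∀ {A B P} → Produce S P → Star (Step S) A B → Sound (_∈ A) →
               (_∈ A) ⊆ P → (_∈ B) ⊆ P
      star-⊆ prod ε                      sound A⊆P = A⊆P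
      star-⊆ prod (st@(stick can) ◅ sts) sound A⊆P =
        star-⊆ prod sts (step-sound st sound)
          (λ { (here refl) → absorb prod sound A⊆P can ; (there q∈) → A⊆P q∈ })

      produce-⊆ : ∀ {P Q} → Produce S P → Produce S Q → P ⊆ Q
      produce-⊆ prodP prodQ Pp = let _ , st , p∈ = produce-stage prodP Pp in
        star-⊆ prodQ st start-sound (λ { (here refl) → produce-seed prodQ }) p∈

      deterministic : Deterministic S
      deterministic = let P , prod = Existence.produce em S cellCode cellCode-injective in
        P , prod , λ prodQ → produce-⊆ prod prodQ , produce-⊆ prodQ prod

      idealTile : Cell → Tile
      idealTile c = mkTile (ideal c 0F ∷ ideal c 1F ∷ ideal c 2F ∷ []) (proj₂ c)

      idealTile-glue : ∀ c k → glueOn (idealTile c) k ≡ ideal c k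
      idealTile-glue c 0F = refl
      idealTile-glue c 1F = refl
      idealTile-glue c 2F = refl

      -- If the cell stayed empty, the ideal tile would collect the full input weight τ there,
      -- against terminality. This drives the induction that covers the plane.
      fill : ∀ {P} → Produce S P → ∀ c → c ≢ source → idealTile c ∈ tiles →
             (∀ k → input c k ≡ true → Occupied P (neighbour c k)) → Occupied P c
      fill {P} prod c c≢source t∈ inputs with em {Occupied P c}
      ... | yes occ = occ
      ... | no none = ⊥-elim (produce-terminal prod
        (p , t∈ , (λ Pq e → none (_ , Pq , e)) , (λ k → proj₁ (heavy k))
           , (λ k → proj₁ (proj₂ (heavy k)))
           , ≤-trans (≤-reflexive (sym (input-weight c c≢source)))
               (+-mono-≤ (+-mono-≤ (proj₂ (proj₂ (heavy 0F))) (proj₂ (proj₂ (heavy 1F))))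
                         (proj₂ (proj₂ (heavy 2F))))))
        where
        p : PlacedTile
        p = idealTile c at proj₁ c
        heavy : ∀ k → ∃[ n ] (Bond P p k n × weight c k ≤ n)
        heavy k with input c k in eq
        ... | false = let n , b = bond P p k in n , b , z≤n
        ... | true  = let q , Pq , e = inputs k eq in _ , shared Pq e ,
          ≤-reflexive (sym (cong₂ strength (idealTile-glue c k)
            (trans (produce-ideal prod Pq k)
              (trans (cong (λ d → ideal d k) e) (ideal-neighbour c k)))))

-- Partition of the tape into shifting blocks

double-injective : ∀ m n → m + m ≡ n + n → m ≡ n
double-injective m n eq = trans (n≡⌊n+n/2⌋ m) (trans (cong ⌊_/2⌋ eq) (sym (n≡⌊n+n/2⌋ n)))

double≢suc-double : ∀ m n → m + m ≢ suc (n + n)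
double≢suc-double m n eq
  with refl ← trans (n≡⌊n+n/2⌋ m) (trans (cong ⌊_/2⌋ eq) (sym (n≡⌈n+n/2⌉ n)))
  = 1+n≢n (sym eq)

halve : ∀ n → ∃[ k ] (n ≡ k + k ⊎ n ≡ suc (k + k))
halve zero    = 0 , inj₁ refl
halve (suc n) with halve n
... | k , inj₁ refl = k , inj₂ refl
... | k , inj₂ refl = suc k , inj₁ (cong suc (sym (+-suc k k)))

-- At time t the tape is cut into blocks of two cells, shifted by one cell at
-- each time step; block x covers the cells 2x − t and 2x − t + 1.
leftCell : ℕ → ℤ → ℤ
leftCell zero    x = x ℤ.+ x
leftCell (suc t) x = ℤ.pred (leftCell t x)

rightCell : ℕ → ℤ → ℤ
rightCell t x = ℤ.suc (leftCell t x)

rightCell-suc : ∀ t x → rightCell (suc t) x ≡ leftCell t x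
rightCell-suc t x = ℤ.suc-pred (leftCell t x)

leftCell-next : ∀ t x → leftCell t (ℤ.suc x) ≡ ℤ.suc (rightCell t x)
leftCell-next zero x = begin
  ℤ.suc x ℤ.+ ℤ.suc x     ≡⟨ ℤ.+-assoc (+ 1) x (ℤ.suc x) ⟩
  ℤ.suc (x ℤ.+ ℤ.suc x)   ≡⟨ cong ℤ.suc (ℤ.+-comm x (ℤ.suc x)) ⟩
  ℤ.suc (ℤ.suc x ℤ.+ x)   ≡⟨ cong ℤ.suc (ℤ.+-assoc (+ 1) x x) ⟩
  ℤ.suc (ℤ.suc (x ℤ.+ x)) ∎
  where open ≡-Reasoning
leftCell-next (suc t) x = begin
  ℤ.pred (leftCell t (ℤ.suc x))  ≡⟨ cong ℤ.pred (leftCell-next t x) ⟩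
  ℤ.pred (ℤ.suc (rightCell t x)) ≡⟨ ℤ.pred-suc (rightCell t x) ⟩
  ℤ.suc (leftCell t x)           ≡⟨ cong ℤ.suc (sym (rightCell-suc t x)) ⟩
  ℤ.suc (rightCell (suc t) x)    ∎
  where open ≡-Reasoning

leftCell-suc : ∀ t x → leftCell (suc t) (ℤ.suc x) ≡ rightCell t x
leftCell-suc t x = trans (cong ℤ.pred (leftCell-next t x)) (ℤ.pred-suc (rightCell t x))

sucℤ-injective : ∀ {i j} → ℤ.suc i ≡ ℤ.suc j → i ≡ j
sucℤ-injective {i} {j} eq = trans (sym (ℤ.pred-suc i)) (trans (cong ℤ.pred eq) (ℤ.pred-suc j))

predℤ-injective : ∀ {i j} → ℤ.pred i ≡ ℤ.pred j → i ≡ j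
predℤ-injective {i} {j} eq = trans (sym (ℤ.suc-pred i)) (trans (cong ℤ.suc eq) (ℤ.suc-pred j))

leftCell-injective : ∀ t x y → leftCell t x ≡ leftCell t y → x ≡ y
leftCell-injective zero (+ m)    (+ n)    eq = cong +_ (double-injective m n (ℤ.+-injective eq))
leftCell-injective zero -[1+ m ] -[1+ n ] eq =
  cong -[1+_] (double-injective m n (suc-injective (ℤ.-[1+-injective eq)))
leftCell-injective (suc t) x y eq = leftCell-injective t x y (predℤ-injective eq)

leftCell≢rightCell : ∀ t x y → leftCell t x ≢ rightCell t y
leftCell≢rightCell zero (+ m)    (+ n)    eq = double≢suc-double m n (ℤ.+-injective eq)
leftCell≢rightCell zero (+ m)    -[1+ n ] ()
leftCell≢rightCell zero -[1+ m ] (+ n)    ()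
leftCell≢rightCell zero -[1+ m ] -[1+ n ] eq = double≢suc-double n m (sym (ℤ.-[1+-injective eq))
leftCell≢rightCell (suc t) x y eq =
  leftCell≢rightCell t x y (predℤ-injective (trans eq (trans (rightCell-suc t y)
    (sym (ℤ.pred-suc (leftCell t y))))))

-- The shift by one cell turns the left cell of a block into the right cell of the same block, and
-- the right cell into the left cell of the next block. A fixed tape cell thus alternates between
-- the two roles.
block : ∀ t i → ∃[ x ] (i ≡ leftCell t x ⊎ i ≡ rightCell t x)
block zero (+ n) with halve n
... | k , inj₁ refl = + k , inj₁ refl
... | k , inj₂ refl = + k , inj₂ refl
block zero -[1+ n ] with halve n
... | k , inj₁ refl = -[1+ k ] , inj₂ refl
... | k , inj₂ refl = -[1+ k ] , inj₁ refl
block (suc t) i with block t i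
... | x , inj₁ eq = x , inj₂ (trans eq (sym (rightCell-suc t x)))
... | x , inj₂ eq = ℤ.suc x , inj₁ (trans eq (sym (leftCell-suc t x)))

-- Simulation of a Turing machine by gates on blocks

module Simulation (M : TuringMachine) where
  open TuringMachine M

  Wire : Set
  Wire = Fin symbols × Maybe (Fin states)

  leftHead rightHead : Fin states → Fin symbols → Fin symbols →
    Maybe (Fin states × Fin symbols × Direction) → Maybe (Wire × Wire)
  leftHead q a b nothing                    = nothing
  leftHead q a b (just (q′ , a′ , right))   = just ((a′ , nothing) , (b , just q′))
  leftHead q a b (just (_ , _ , left))      = just ((a , just q) , (b , nothing))
  rightHead q a b nothing                   = nothing
  rightHead q a b (just (q′ , b′ , left))   = just ((a , just q′) , (b′ , nothing))
  rightHead q a b (just (_ , _ , right))    = just ((a , nothing) , (b , just q))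

  -- A head about to leave the block waits for the next time step, when its cell
  -- shares a block with the other neighbour.
  gate : Wire → Wire → Maybe (Wire × Wire)
  gate (a , just q)  (b , nothing) = leftHead q a b (δ q a)
  gate (a , nothing) (b , just q)  = rightHead q a b (δ q b)
  -- Meant for blocks without a head. Two heads never share a block in a run, so passing them
  -- through is only a default.
  gate l             r             = just (l , r)

  open Configuration

  next : Configuration M → Fin states × Fin symbols × Direction → Configuration M
  next c (q , a , d) = ⟨ q , move M d (head c) , write M (head c) a (tape c) ⟩

  wire : Configuration M → ℤ → Wire
  wire c i with i ℤ.≟ head c
  ... | yes _ = tape c i , just (state c)
  ... | no _  = tape c i , nothing

  wire-head : ∀ c {i} → i ≡ head c → wire c i ≡ (tape c i , just (state c))
  wire-head c {i} eq with i ℤ.≟ head c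
  ... | yes _ = refl
  ... | no ¬e = contradiction eq ¬e

  wire-tape : ∀ c {i} → i ≢ head c → wire c i ≡ (tape c i , nothing)
  wire-tape c {i} ne with i ℤ.≟ head c
  ... | yes e = contradiction e ne
  ... | no _  = refl

  write-head : ∀ i a T → write M i a T i ≡ a
  write-head i a T with i ℤ.≟ i
  ... | yes _ = refl
  ... | no ¬e = contradiction refl ¬e

  write-tape : ∀ {i j} a T → j ≢ i → write M i a T j ≡ T j
  write-tape {i} {j} a T ne with j ℤ.≟ i
  ... | yes e = contradiction e ne
  ... | no _  = refl

  -- The global counterpart of `gate`. Keeping the configuration when there is no transition makes
  -- `run` total, so wires exist at every time even after halting.
  tickIn : ∀ t c → ∃[ x ] (head c ≡ leftCell t x ⊎ head c ≡ rightCell t x) →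
           Maybe (Fin states × Fin symbols × Direction) → Configuration M
  tickIn t c (_ , inj₁ _) (just (q , a , right)) = next c (q , a , right)
  tickIn t c (_ , inj₂ _) (just (q , a , left))  = next c (q , a , left)
  tickIn t c _            _                      = c

  tick : ℕ → Configuration M → Configuration M
  tick t c = tickIn t c (block t (head c)) (action M c)

  gateIn : ℕ → Configuration M → ℤ → Maybe (Wire × Wire)
  gateIn t c x = gate (wire c (leftCell t x)) (wire c (rightCell t x))

  i≢suc : ∀ i → i ≢ ℤ.suc i
  i≢suc i = ℤ.i≢suc[i]

  next-tape : ∀ c q a d {i} → i ≢ head c → i ≢ move M d (head c) →
              wire (next c (q , a , d)) i ≡ (tape c i , nothing)
  next-tape c q a d ne ne′ =
    trans (wire-tape (next c (q , a , d)) ne′) (cong (_, nothing) (write-tape a (tape c) ne))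

  gateIn-left : ∀ t c {x} → head c ≡ leftCell t x →
    gateIn t c x ≡ leftHead (state c) (tape c (leftCell t x)) (tape c (rightCell t x)) (action M c)
  gateIn-left t ⟨ q , h , T ⟩ refl =
    cong₂ gate (wire-head ⟨ q , h , T ⟩ refl) (wire-tape ⟨ q , h , T ⟩ (≢-sym (i≢suc h)))

  gateIn-right : ∀ t c {x} → head c ≡ rightCell t x →
    gateIn t c x ≡ rightHead (state c) (tape c (leftCell t x)) (tape c (rightCell t x)) (action M c)
  gateIn-right t ⟨ q , h , T ⟩ {x} refl =
    cong₂ gate (wire-tape ⟨ q , h , T ⟩ (i≢suc (leftCell t x))) (wire-head ⟨ q , h , T ⟩ refl)

  gateIn-tape : ∀ t c {x} → leftCell t x ≢ head c → rightCell t x ≢ head c →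
    gateIn t c x ≡ just ((tape c (leftCell t x) , nothing) , (tape c (rightCell t x) , nothing))
  gateIn-tape t c neL neR = cong₂ gate (wire-tape c neL) (wire-tape c neR)

  Gated : ℕ → Configuration M → Configuration M → ℤ → Set
  Gated t c c′ x = gateIn t c x ≡ just (wire c′ (leftCell t x) , wire c′ (rightCell t x))

  gated-stay : ∀ t c {x} → leftCell t x ≢ head c → rightCell t x ≢ head c → Gated t c c x
  gated-stay t c neL neR = trans (gateIn-tape t c neL neR)
    (cong₂ (λ l r → just (l , r)) (sym (wire-tape c neL)) (sym (wire-tape c neR)))

  -- The old and the new head position both lie in block `y`, so any other block sees neither a head
  -- nor the written symbol.
  gated-next : ∀ t c q a d x y → head c ≡ leftCell t y ⊎ head c ≡ rightCell t y →
    move M d (head c) ≡ leftCell t y ⊎ move M d (head c) ≡ rightCell t y →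
    x ≢ y → Gated t c (next c (q , a , d)) x
  gated-next t c q a d x y pos pos′ x≢y = trans (gateIn-tape t c (offL pos) (offR pos))
    (cong₂ (λ l r → just (l , r)) (sym (next-tape c q a d (offL pos) (offL pos′)))
                                  (sym (next-tape c q a d (offR pos) (offR pos′))))
    where
    offL : ∀ {i} → i ≡ leftCell t y ⊎ i ≡ rightCell t y → leftCell t x ≢ i
    offL (inj₁ refl) e = x≢y (leftCell-injective t x y e)
    offL (inj₂ refl) e = leftCell≢rightCell t x y e
    offR : ∀ {i} → i ≡ leftCell t y ⊎ i ≡ rightCell t y → rightCell t x ≢ i
    offR (inj₁ refl) e = leftCell≢rightCell t y x (sym e)
    offR (inj₂ refl) e = x≢y (leftCell-injective t x y (sucℤ-injective e))

  -- The local gates together compute the global `tick`. The blocked alternative arises only in the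
  -- head's own block; all other blocks pass their cells on even when the machine has halted.
  gated-tick : ∀ t c → (pos : ∃[ y ] (head c ≡ leftCell t y ⊎ head c ≡ rightCell t y)) →
    ∀ {m} → action M c ≡ m → ∀ x →
    Gated t c (tickIn t c pos m) x ⊎ (m ≡ nothing × gateIn t c x ≡ nothing)
  gated-tick t c (y , pos) eq x with x ℤ.≟ y
  gated-tick t c (y , inj₁ e) {nothing} eq x | yes refl =
    inj₂ (refl , trans (gateIn-left t c e) (cong (leftHead _ _ _) eq))
  gated-tick t c (y , inj₂ e) {nothing} eq x | yes refl =
    inj₂ (refl , trans (gateIn-right t c e) (cong (rightHead _ _ _) eq))
  gated-tick t c@(⟨ q , h , T ⟩) (y , inj₁ refl) {just (q′ , a , right)} eq x | yes refl =
    inj₁ (trans (gateIn-left t c refl) (trans (cong (leftHead _ _ _) eq)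
      (cong₂ (λ l r → just (l , r))
        (sym (trans (wire-tape c′ (i≢suc h)) (cong (_, nothing) (write-head h a T))))
        (sym (trans (wire-head c′ refl) (cong (_, just q′) (write-tape a T (≢-sym (i≢suc h)))))))))
    where c′ = next c (q′ , a , right)
  gated-tick t c@(⟨ q , h , T ⟩) (y , inj₁ refl) {just (q′ , a , left)} eq x | yes refl =
    inj₁ (trans (gateIn-left t c refl) (trans (cong (leftHead _ _ _) eq)
      (cong₂ (λ l r → just (l , r)) (sym (wire-head c refl)) (sym (wire-tape c (≢-sym (i≢suc h)))))))
  gated-tick t c@(⟨ q , h , T ⟩) (y , inj₂ refl) {just (q′ , a , left)} eq x | yes refl =
    inj₁ (trans (gateIn-right t c refl) (trans (cong (rightHead _ _ _) eq)
      (cong₂ (λ l r → just (l , r))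
        (sym (trans (wire-head c′ (sym (ℤ.pred-suc i))) (cong (_, just q′) (write-tape a T (i≢suc i)))))
        (sym (trans (wire-tape c′ (λ e → i≢suc i (sym (trans e (ℤ.pred-suc i)))))
          (cong (_, nothing) (write-head h a T)))))))
    where
    c′ = next c (q′ , a , left)
    i = leftCell t x
  gated-tick t c@(⟨ q , h , T ⟩) (y , inj₂ refl) {just (q′ , a , right)} eq x | yes refl =
    inj₁ (trans (gateIn-right t c refl) (trans (cong (rightHead _ _ _) eq)
      (cong₂ (λ l r → just (l , r)) (sym (wire-tape c (i≢suc (leftCell t x)))) (sym (wire-head c refl)))))
  gated-tick t c (y , pos@(inj₁ e)) {just (q , a , right)} eq x | no x≢y =
    inj₁ (gated-next t c q a right x y pos (inj₂ (cong ℤ.suc e)) x≢y)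
  gated-tick t c (y , pos@(inj₂ e)) {just (q , a , left)} eq x | no x≢y =
    inj₁ (gated-next t c q a left x y pos (inj₁ (trans (cong ℤ.pred e) (ℤ.pred-suc (leftCell t y)))) x≢y)
  gated-tick t ⟨ q , h , T ⟩ (y , inj₁ refl) {nothing} eq x | no x≢y =
    inj₁ (gated-stay t _ (λ e → x≢y (leftCell-injective t x y e)) (λ e → leftCell≢rightCell t y x (sym e)))
  gated-tick t ⟨ q , h , T ⟩ (y , inj₁ refl) {just (_ , _ , left)} eq x | no x≢y =
    inj₁ (gated-stay t _ (λ e → x≢y (leftCell-injective t x y e)) (λ e → leftCell≢rightCell t y x (sym e)))
  gated-tick t ⟨ q , h , T ⟩ (y , inj₂ refl) {nothing} eq x | no x≢y =
    inj₁ (gated-stay t _ (leftCell≢rightCell t x y) (λ e → x≢y (leftCell-injective t x y (sucℤ-injective e))))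
  gated-tick t ⟨ q , h , T ⟩ (y , inj₂ refl) {just (_ , _ , right)} eq x | no x≢y =
    inj₁ (gated-stay t _ (leftCell≢rightCell t x y) (λ e → x≢y (leftCell-injective t x y (sucℤ-injective e))))

  tickIn-reach : ∀ t c pos {m} → action M c ≡ m → Star (_⟶_ M) c (tickIn t c pos m)
  tickIn-reach t c (_ , inj₁ _) {just (_ , _ , right)} eq = step eq ◅ ε
  tickIn-reach t c (_ , inj₂ _) {just (_ , _ , left)}  eq = step eq ◅ ε
  tickIn-reach t c (_ , inj₁ _) {just (_ , _ , left)}  eq = ε
  tickIn-reach t c (_ , inj₂ _) {just (_ , _ , right)} eq = ε
  tickIn-reach t c (_ , inj₁ _) {nothing} eq = ε
  tickIn-reach t c (_ , inj₂ _) {nothing} eq = ε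

  -- A move that would leave the block waits once. One tick later the head's cell has the opposite
  -- role in its block, and the same move stays inside, so two ticks always suffice.
  tick-step : ∀ t {c c′} → _⟶_ M c c′ → tick t c ≡ c′ ⊎ tick (suc t) (tick t c) ≡ c′
  tick-step t {c} (step {q} {a} {d} eq) = go d eq
    where
    go : ∀ d → action M c ≡ just (q , a , d) →
         tick t c ≡ next c (q , a , d) ⊎ tick (suc t) (tick t c) ≡ next c (q , a , d)
    go d eq with block t (head c) in eqb
    go right eq | _ , inj₁ _ rewrite eq = inj₁ refl
    go left  eq | _ , inj₂ _ rewrite eq = inj₁ refl
    go left  eq | _ , inj₁ _ rewrite eq | eqb | eq = inj₂ refl
    go right eq | _ , inj₂ _ rewrite eq | eqb | eq = inj₂ refl

  module Run (w : Word M) where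

    run : ℕ → Configuration M
    run zero    = initialConfiguration M w
    run (suc t) = tick t (run t)

    run-gate : ∀ t x → Gated t (run t) (run (suc t)) x ⊎
               (action M (run t) ≡ nothing × gateIn t (run t) x ≡ nothing)
    run-gate t x = gated-tick t (run t) (block t _) refl x

    run-stuck : ∀ t → action M (run t) ≡ nothing → ∃[ x ] (gateIn t (run t) x ≡ nothing)
    run-stuck t eq with block t (Configuration.head (run t))
    ... | x , inj₁ e = x , trans (gateIn-left t (run t) e) (cong (leftHead _ _ _) eq)
    ... | x , inj₂ e = x , trans (gateIn-right t (run t) e) (cong (rightHead _ _ _) eq)

    run-reach : ∀ t → Star (_⟶_ M) (run 0) (run t)
    run-reach zero    = ε
    run-reach (suc t) = run-reach t ◅◅ tickIn-reach t (run t) (block t _) refl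

    reach-run : ∀ t {c d} → run t ≡ c → Star (_⟶_ M) c d → ∃[ u ] (run u ≡ d)
    reach-run t eq ε = t , eq
    reach-run t refl (s ◅ ss) with tick-step t s
    ... | inj₁ eq = reach-run (suc t) eq ss
    ... | inj₂ eq = reach-run (suc (suc t)) eq ss

    halts⇒stuck : Halts M w → ∃[ t ] (action M (run t) ≡ nothing)
    halts⇒stuck (c , reach , halted) with t , refl ← reach-run 0 refl reach = t , halted

    stuck⇒halts : ∀ t → action M (run t) ≡ nothing → Halts M w
    stuck⇒halts t eq = run t , run-reach t , eq

+-sucʳ : ∀ x y → x ℤ.+ ℤ.suc y ≡ ℤ.suc (x ℤ.+ y)
+-sucʳ x y = trans (ℤ.+-comm x (ℤ.suc y)) (trans (ℤ.+-assoc (+ 1) y x) (cong ℤ.suc (ℤ.+-comm y x)))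

+-sucˡ : ∀ x y → ℤ.suc x ℤ.+ y ≡ ℤ.suc (x ℤ.+ y)
+-sucˡ = ℤ.+-assoc (+ 1)

-- Keeps the labels of the right half of the strip in a finite set: dropping beyond the end stays at
-- the empty suffix.
drop-tails : ∀ {A : Set} n {s : List A} w → s ∈ tails w → drop n s ∈ tails w
drop-tails zero    w s∈ = s∈
drop-tails (suc n) [] (here refl) = here refl
drop-tails (suc n) (a ∷ w) (here refl) = there (drop-tails n w (here refl))
drop-tails (suc n) (a ∷ w) (there s∈)  = there (drop-tails (suc n) w s∈)

-- The tile system of a machine and a word

module Tiling (m : ℕ) (M : TuringMachine) (w : Word M) where
  open TuringMachine M
  open Simulation M
  open Run w

  τ : ℕ
  τ = suc (suc m)

  Name : Set
  Name = ℕ × List Wire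

  -- The first component fixes the strength: 0 and 1 are the cooperating glues of
  -- sides 0 and 2, everything else bonds on its own.
  pattern fill₀      = 0 , []
  pattern fill₂      = 1 , []
  pattern fill₁      = 2 , []
  pattern south r    = 0 , r ∷ []
  pattern west l     = 1 , l ∷ []
  pattern both l r   = 2 , l ∷ r ∷ []
  pattern right₀ s   = 3 , s
  pattern right₂ s   = 4 , s
  pattern left₀      = 5 , []
  pattern left₂      = 6 , []

  stateCode : Maybe (Fin states) → ℕ
  stateCode nothing  = 0
  stateCode (just q) = suc (toℕ q)

  stateCode-injective : ∀ s s′ → stateCode s ≡ stateCode s′ → s ≡ s′
  stateCode-injective nothing  nothing   _  = refl
  stateCode-injective (just q) (just q′) eq = cong just (toℕ-injective (suc-injective eq))

  wiresCode : List Wire → Label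
  wiresCode []             = []
  wiresCode ((a , s) ∷ ws) = toℕ a ∷ stateCode s ∷ wiresCode ws

  wiresCode-injective : ∀ v v′ → wiresCode v ≡ wiresCode v′ → v ≡ v′
  wiresCode-injective []            []              _  = refl
  wiresCode-injective ((a , s) ∷ v) ((a′ , s′) ∷ v′) eq =
    let a≡ , eq′ = ∷-injective eq
        s≡ , v≡  = ∷-injective eq′
    in cong₂ _∷_ (cong₂ _,_ (toℕ-injective a≡) (stateCode-injective s s′ s≡))
                 (wiresCode-injective v v′ v≡)

  force : ℕ → ℕ
  force 0 = 1
  force 1 = suc m
  force _ = τ

  force-positive : ∀ k → 0 < force k
  force-positive 0             = s≤s z≤n
  force-positive 1             = s≤s z≤n
  force-positive (suc (suc _)) = s≤s z≤n

  named : Name → Glue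
  named (k , ws) = glue (k ∷ wiresCode ws) (force k)

  glue-injectiveˡ : ∀ {a b k n} → glue a k ≡ glue b n → a ≡ b
  glue-injectiveˡ refl = refl

  named-injective : ∀ {n n′} → named n ≡ named n′ → n ≡ n′
  named-injective eq =
    let k≡ , v≡ = ∷-injective (glue-injectiveˡ eq)
    in cong₂ _,_ k≡ (wiresCode-injective _ _ v≡)

  named-strength : ∀ n → strength (named n) (named n) ≡ force (proj₁ n)
  named-strength (k , ws) = strength-self (k ∷ wiresCode ws) (force k)

  record Scheme : Set where
    constructor scheme
    field
      facing            : Orientation
      name₀ name₁ name₂ : Name

  open Scheme

  nameOn : Scheme → Side → Name
  nameOn s 0F = name₀ s
  nameOn s 1F = name₁ s
  nameOn s 2F = name₂ s

  tileOf : Scheme → Tile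
  tileOf (scheme o n₀ n₁ n₂) = mkTile (named n₀ ∷ named n₁ ∷ named n₂ ∷ []) o

  tileOf-glue : ∀ s k → glueOn (tileOf s) k ≡ named (nameOn s k)
  tileOf-glue s 0F = refl
  tileOf-glue s 1F = refl
  tileOf-glue s 2F = refl

  blankWire : Wire
  blankWire = blank , nothing

  first : List Wire → Wire
  first []      = blankWire
  first (v ∷ _) = v

  input-wires : List Wire
  input-wires = map (_, nothing) w

  -- The seed holds block 0, that is, tape cells 0 and 1 with the head on cell 0. The strip to its
  -- right therefore starts after two symbols, and the strip to its left is blank throughout.
  seedUp leftUp leftDown fillUp fillDown : Scheme
  seedUp = scheme up (right₀ (drop 2 input-wires))
    (both (proj₁ (first input-wires) , just initial) (first (drop 1 input-wires))) left₂
  leftUp   = scheme up left₀ (both blankWire blankWire) left₂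
  leftDown = scheme down left₀ fill₁ left₂
  fillUp   = scheme up fill₀ fill₁ fill₂
  fillDown = scheme down fill₀ fill₁ fill₂

  -- The parameter is the input still to be spelled, and each up tile consumes the two symbols of
  -- its block. Once it is empty, `first` supplies blanks and the same two tiles repeat for ever.
  rightUp rightDown : List Wire → Scheme
  rightUp s   = scheme up (right₀ (drop 2 s)) (both (first s) (first (drop 1 s))) (right₂ s)
  rightDown s = scheme down (right₀ s) fill₁ (right₂ s)

  -- The order reflects the shift of the blocks: the left output of a gate leaves through side 0 and
  -- arrives as a right cell, the right output leaves through side 2 and arrives as a left cell.
  meet : Wire → Wire → Scheme
  meet l r = scheme up (south r) (both l r) (west l)

  -- A blocked gate gets no tile of its own; fillDown is a harmless repetition.
  reaction : Wire → Wire → Maybe (Wire × Wire) → Scheme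
  reaction l r (just (l′ , r′)) = scheme down (south l′) (both l r) (west r′)
  reaction l r nothing          = fillDown

  react : Wire → Wire → Scheme
  react l r = reaction l r (gate l r)

  wires : List Wire
  wires = cartesianProduct (allFin symbols) (nothing ∷ map just (allFin states))

  ∈-wires : ∀ v → v ∈ wires
  ∈-wires (a , nothing) = ∈-cartesianProduct⁺ (∈-allFin a) (here refl)
  ∈-wires (a , just q)  = ∈-cartesianProduct⁺ (∈-allFin a) (there (∈-map⁺ just (∈-allFin q)))

  singles rights meets reacts : List Scheme
  singles = seedUp ∷ leftUp ∷ leftDown ∷ fillUp ∷ fillDown ∷ []
  rights  = map rightUp (tails input-wires) ++ map rightDown (tails input-wires)
  meets   = cartesianProductWith meet wires wires
  reacts  = cartesianProductWith react wires wires

  schemes : List Scheme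
  schemes = singles ++ rights ++ meets ++ reacts

  system : TileSystem τ
  system = record
    { tiles = map tileOf schemes ; seed = tileOf seedUp ; seed∈tiles = here refl }

  -- A `react-view` carries the equation that its gate is open; this evidence is what the presence
  -- of such a tile in a produce later yields.
  data View : Scheme → Set where
    seed-view      : View seedUp
    leftUp-view    : View leftUp
    leftDown-view  : View leftDown
    fillUp-view    : View fillUp
    fillDown-view  : View fillDown
    rightUp-view   : ∀ s → View (rightUp s)
    rightDown-view : ∀ s → View (rightDown s)
    meet-view      : ∀ l r → View (meet l r)
    react-view     : ∀ l r {l′ r′} → gate l r ≡ just (l′ , r′) →
                     View (scheme down (south l′) (both l r) (west r′))

  view-react : ∀ l r {g} → gate l r ≡ g → View (reaction l r g)
  view-react l r {just _}  eq = react-view l r eq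
  view-react l r {nothing} eq = fillDown-view

  view : ∀ {s} → s ∈ schemes → View s
  view t∈ with ∈-++⁻ singles t∈
  ... | inj₁ (here refl)                                 = seed-view
  ... | inj₁ (there (here refl))                         = leftUp-view
  ... | inj₁ (there (there (here refl)))                 = leftDown-view
  ... | inj₁ (there (there (there (here refl))))         = fillUp-view
  ... | inj₁ (there (there (there (there (here refl))))) = fillDown-view
  ... | inj₂ t∈′ with ∈-++⁻ rights t∈′
  ... | inj₁ t∈″ with ∈-++⁻ (map rightUp (tails input-wires)) t∈″
  ... | inj₁ t∈‴ with s , _ , refl ← ∈-map⁻ rightUp t∈‴ = rightUp-view s
  ... | inj₂ t∈‴ with s , _ , refl ← ∈-map⁻ rightDown t∈‴ = rightDown-view s
  view t∈ | inj₂ t∈′ | inj₂ t∈″ with ∈-++⁻ meets t∈″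
  ... | inj₁ t∈‴ with l , r , _ , _ , refl ← ∈-cartesianProductWith⁻ meet wires wires t∈‴ = meet-view l r
  ... | inj₂ t∈‴ with l , r , _ , _ , refl ← ∈-cartesianProductWith⁻ react wires wires t∈‴ =
    view-react l r refl

  ∈-rightUp : ∀ {s} → s ∈ tails input-wires → rightUp s ∈ schemes
  ∈-rightUp s∈ = ∈-++⁺ʳ singles (∈-++⁺ˡ (∈-++⁺ˡ (∈-map⁺ rightUp s∈)))

  ∈-rightDown : ∀ {s} → s ∈ tails input-wires → rightDown s ∈ schemes
  ∈-rightDown s∈ = ∈-++⁺ʳ singles (∈-++⁺ˡ
    (∈-++⁺ʳ (map rightUp (tails input-wires)) (∈-map⁺ rightDown s∈)))

  ∈-meet : ∀ l r → meet l r ∈ schemes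
  ∈-meet l r = ∈-++⁺ʳ singles (∈-++⁺ʳ rights (∈-++⁺ˡ
    (∈-cartesianProductWith⁺ meet (∈-wires l) (∈-wires r))))

  ∈-react : ∀ l r → react l r ∈ schemes
  ∈-react l r = ∈-++⁺ʳ singles (∈-++⁺ʳ rights (∈-++⁺ʳ meets
    (∈-cartesianProductWith⁺ react (∈-wires l) (∈-wires r))))

  -- The ideal labelling of the plane and its input sides

  suffix : ℕ → List Wire
  suffix zero    = drop 2 input-wires
  suffix (suc n) = drop 2 (suffix n)

  suffix-tails : ∀ n → suffix n ∈ tails input-wires
  suffix-tails zero    = drop-tails 2 input-wires (here refl)
  suffix-tails (suc n) = drop-tails 2 input-wires (suffix-tails n)

  -- The seed and each of the next `n` up tiles of the strip consume two symbols, so `suffix n`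
  -- starts at tape cell 2n + 2.
  suffix-drop : ∀ n → suffix n ≡ drop (suc n + suc n) input-wires
  suffix-drop zero    = refl
  suffix-drop (suc n) = begin
    drop 2 (suffix n)                          ≡⟨ cong (drop 2) (suffix-drop n) ⟩
    drop 2 (drop (suc n + suc n) input-wires)  ≡⟨ drop-drop (suc n + suc n) 2 input-wires ⟩
    drop (suc n + suc n + 2) input-wires       ≡⟨ cong (λ k → drop k input-wires) lemma ⟩
    drop (suc (suc n) + suc (suc n)) input-wires ∎
    where
    open ≡-Reasoning
    lemma : suc n + suc n + 2 ≡ suc (suc n) + suc (suc n)
    lemma = trans (+-comm (suc n + suc n) 2) (cong (suc ∘ suc) (sym (+-suc n (suc n))))

  first-drop : ∀ v k → first (drop k (map (_, nothing) v)) ≡ (inputTape M v (+ k) , nothing)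
  first-drop []      zero    = refl
  first-drop []      (suc k) = refl
  first-drop (a ∷ v) zero    = refl
  first-drop (a ∷ v) (suc k) = first-drop v k

  inputTape-negative : ∀ v n → inputTape M v -[1+ n ] ≡ blank
  inputTape-negative []      n = refl
  inputTape-negative (_ ∷ _) n = refl

  initial-positive : ∀ k → wire (run 0) (+ suc k) ≡ first (drop (suc k) input-wires)
  initial-positive k = trans (wire-tape (run 0) λ ()) (sym (first-drop w (suc k)))

  initial-zero : wire (run 0) (+ 0) ≡ (proj₁ (first input-wires) , just initial)
  initial-zero = trans (wire-head (run 0) refl)
    (cong (λ v → proj₁ v , just initial) (sym (first-drop w 0)))

  initial-negative : ∀ k → wire (run 0) -[1+ k ] ≡ blankWire
  initial-negative k = trans (wire-tape (run 0) λ ()) (cong (_, nothing) (inputTape-negative w k))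

  -- Here t = x + y is the time of the cell at (x , y).
  horizontal diagonal slanted : ℤ → ℤ → Name
  horizontal (+ suc n) x        = south (wire (run (suc n)) (rightCell (suc n) x))
  horizontal (+ 0)     (+ n)    = right₀ (suffix n)
  horizontal (+ 0)     -[1+ _ ] = left₀
  horizontal -[1+ _ ]  _        = fill₀
  diagonal (+ n)    x = both (wire (run n) (leftCell n x)) (wire (run n) (rightCell n x))
  diagonal -[1+ _ ] _ = fill₁
  slanted (+ suc n) x         = west (wire (run (suc n)) (leftCell (suc n) x))
  -- Side 2 of the up cell at `suc n` is reached from the up cell at `n` through the down cell below
  -- it, so it carries the word that leaves block `n`.
  slanted (+ 0)     (+ suc n) = right₂ (suffix n)
  slanted (+ 0)     (+ 0)     = left₂
  slanted (+ 0)     -[1+ _ ]  = left₂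
  slanted -[1+ _ ]  _         = fill₂

  nameAt : Orientation → ℤ → ℤ → Side → Name
  nameAt up   t x 0F = horizontal t x
  nameAt up   t x 1F = diagonal t x
  nameAt up   t x 2F = slanted t x
  nameAt down t x 0F = horizontal (ℤ.suc t) x
  nameAt down t x 1F = diagonal t x
  nameAt down t x 2F = slanted (ℤ.suc t) (ℤ.suc x)

  schemeAt : Orientation → ℤ → ℤ → Scheme
  schemeAt o t x = scheme o (nameAt o t x 0F) (nameAt o t x 1F) (nameAt o t x 2F)

  name : Cell → Side → Name
  name ((x , y) , o) = nameAt o (x ℤ.+ y) x

  only : Side → Side → Bool
  only j k = does (j Fin.≟ k)

  outer : Side → Bool
  outer 0F = true
  outer 1F = false
  outer 2F = true

  -- Growth leaves the strip in both directions of time. The strip consists of the up cells at time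
  -- 0 and the down cells at time -1, each fed by its neighbour nearer to the seed; later cells are
  -- fed from the strip forwards, earlier ones from it backwards.
  inputAt : Orientation → ℤ → ℤ → Side → Bool
  inputAt up   (+ suc _)    _         = outer
  inputAt up   (+ 0)        (+ suc _) = only 2F
  inputAt up   (+ 0)        (+ 0)     = λ _ → false
  inputAt up   (+ 0)        -[1+ _ ]  = only 0F
  inputAt up   -[1+ _ ]     _         = only 1F
  inputAt down (+ _)        _         = only 1F
  inputAt down -[1+ 0 ]     (+ _)     = only 0F
  inputAt down -[1+ 0 ]     -[1+ _ ]  = only 2F
  inputAt down -[1+ suc _ ] _         = outer

  input : Cell → Side → Bool
  input ((x , y) , o) = inputAt o (x ℤ.+ y) x

  open LocalDeterminism system (λ c k → named (name c k)) input

  -- Verification of local determinism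

  name-neighbour : ∀ c k → name (neighbour c k) k ≡ name c k
  name-neighbour ((x , y) , up) 0F = cong (λ t → horizontal t x)
    (trans (cong ℤ.suc (ℤ.+-pred x y)) (ℤ.suc-pred (x ℤ.+ y)))
  name-neighbour ((x , y) , up) 1F = refl
  name-neighbour ((x , y) , up) 2F = cong₂ slanted
    (trans (cong ℤ.suc (ℤ.pred-+ x y)) (ℤ.suc-pred (x ℤ.+ y))) (ℤ.suc-pred x)
  name-neighbour ((x , y) , down) 0F = cong (λ t → horizontal t x) (+-sucʳ x y)
  name-neighbour ((x , y) , down) 1F = refl
  name-neighbour ((x , y) , down) 2F = cong (λ t → slanted t (ℤ.suc x)) (+-sucˡ x y)

  flow-up₀ : ∀ t x → inputAt up t x 0F ≡ false → inputAt down (ℤ.pred t) x 0F ≡ true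
  flow-up₀ (+ 0)     (+ 0)     _ = refl
  flow-up₀ (+ 0)     (+ suc _) _ = refl
  flow-up₀ -[1+ _ ]  _         _ = refl

  flow-up₂ : ∀ t x → inputAt up t x 2F ≡ false → inputAt down (ℤ.pred t) (ℤ.pred x) 2F ≡ true
  flow-up₂ (+ 0)     (+ 0)    _ = refl
  flow-up₂ (+ 0)     -[1+ _ ] _ = refl
  flow-up₂ -[1+ _ ]  _        _ = refl

  flow-up₁ : ∀ t x → inputAt up t x 1F ≡ false → inputAt down t x 1F ≡ true
  flow-up₁ (+ _) _ _ = refl

  flow-down₀ : ∀ t x → inputAt down t x 0F ≡ false → inputAt up (ℤ.suc t) x 0F ≡ true
  flow-down₀ (+ _)    _        _ = refl
  flow-down₀ -[1+ 0 ] -[1+ _ ] _ = refl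

  flow-down₁ : ∀ t x → inputAt down t x 1F ≡ false → inputAt up t x 1F ≡ true
  flow-down₁ -[1+ _ ] _ _ = refl

  flow-down₂ : ∀ t x → inputAt down t x 2F ≡ false → inputAt up (ℤ.suc t) (ℤ.suc x) 2F ≡ true
  flow-down₂ (+ _)    _     _ = refl
  flow-down₂ -[1+ 0 ] (+ _) _ = refl

  input-flow : ∀ c k → input c k ≡ false → input (neighbour c k) k ≡ true
  input-flow ((x , y) , up)   0F e rewrite ℤ.+-pred x y = flow-up₀ (x ℤ.+ y) x e
  input-flow ((x , y) , up)   1F e = flow-up₁ (x ℤ.+ y) x e
  input-flow ((x , y) , up)   2F e rewrite ℤ.pred-+ x y = flow-up₂ (x ℤ.+ y) x e
  input-flow ((x , y) , down) 0F e rewrite +-sucʳ x y   = flow-down₀ (x ℤ.+ y) x e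
  input-flow ((x , y) , down) 1F e = flow-down₁ (x ℤ.+ y) x e
  input-flow ((x , y) , down) 2F e rewrite +-sucˡ x y   = flow-down₂ (x ℤ.+ y) x e

  -- Recognises the seed's cell from time and `x`, the coordinates on which the case analyses split.
  data Source : Orientation → ℤ → ℤ → Set where
    source-at : Source up 0ℤ 0ℤ

  source-unique : ∀ x y {o} → Source o (x ℤ.+ y) x → ((x , y) , o) ≡ source
  source-unique x y s = go (x ℤ.+ y) refl s
    where
    go : ∀ t {o} → x ℤ.+ y ≡ t → Source o t x → ((x , y) , o) ≡ source
    go _ eq source-at = cong (λ z → (0ℤ , z) , up) (trans (sym (ℤ.+-identityˡ y)) eq)

  weightAt : Orientation → ℤ → ℤ → Side → ℕ
  weightAt o t x k = if inputAt o t x k then force (proj₁ (nameAt o t x k)) else 0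

  weight-weightAt : ∀ x y o k → weight ((x , y) , o) k ≡ weightAt o (x ℤ.+ y) x k
  weight-weightAt x y o k =
    cong (λ n → if input c k then n else 0) (named-strength (name c k))
    where c = (x , y) , o

  weightAt-total : ∀ o t x → ¬ Source o t x →
    weightAt o t x 0F + weightAt o t x 1F + weightAt o t x 2F ≡ τ
  weightAt-total up   (+ suc _)    _         _ = refl
  weightAt-total up   (+ 0)        (+ suc _) _ = refl
  weightAt-total up   (+ 0)        (+ 0)     ¬s = contradiction source-at ¬s
  weightAt-total up   (+ 0)        -[1+ _ ]  _ = trans (+-identityʳ (τ + 0)) (+-identityʳ τ)
  weightAt-total up   -[1+ _ ]     _         _ = +-identityʳ τ
  weightAt-total down (+ _)        _         _ = +-identityʳ τ
  weightAt-total down -[1+ 0 ]     (+ _)     _ = trans (+-identityʳ (τ + 0)) (+-identityʳ τ)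
  -- Side 2 of a down cell refers to `ℤ.suc x`, which is zero here and negative in the next clause;
  -- the split lets it compute.
  weightAt-total down -[1+ 0 ]     -[1+ 0 ]      _ = refl
  weightAt-total down -[1+ 0 ]     -[1+ suc _ ]  _ = refl
  weightAt-total down -[1+ suc _ ] _         _ = refl

  initial-left : ∀ n → leftUp ≡ schemeAt up (+ 0) -[1+ n ]
  initial-left n = sym (cong₂ (λ l r → scheme up left₀ (both l r) left₂)
    (initial-negative (suc (n + n))) (initial-negative (n + n)))

  -- Block n + 1 holds the tape cells 2n + 2 and 2n + 3, whose symbols are the first two of
  -- `suffix n`; hence the strip spells the initial tape.
  initial-right : ∀ n → rightUp (suffix n) ≡ schemeAt up (+ 0) (+ suc n)
  initial-right n = cong₂ (λ l r → scheme up (right₀ (suffix (suc n))) (both l r) (right₂ (suffix n)))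
    (trans (cong first (suffix-drop n)) (sym (initial-positive (n + suc n))))
    (trans (cong (first ∘ drop 1) (suffix-drop n))
      (trans (cong first (trans (drop-drop (suc n + suc n) 1 input-wires)
                                (cong (λ k → drop k input-wires) (+-comm (suc n + suc n) 1))))
        (sym (initial-positive (suc n + suc n)))))

  initial-seed : seedUp ≡ schemeAt up (+ 0) (+ 0)
  initial-seed = sym (cong₂ (λ l r → scheme up (right₀ (suffix 0)) (both l r) left₂)
    initial-zero (initial-positive 0))

  chain-left : ∀ n → leftDown ≡ schemeAt down -[1+ 0 ] -[1+ n ]
  chain-left zero    = refl
  chain-left (suc n) = refl

  react-run : ∀ n x {l r} → gateIn n (run n) x ≡ just (l , r) →
    scheme down (south l) (diagonal (+ n) x) (west r) ≡ schemeAt down (+ n) x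
  react-run n x eq with run-gate n x
  ... | inj₂ (_ , stuck) with () ← trans (sym eq) stuck
  ... | inj₁ gated with refl ← trans (sym eq) gated =
    cong₂ (λ i j → scheme down (south (wire (run (suc n)) i)) (diagonal (+ n) x)
                               (west (wire (run (suc n)) j)))
      (sym (rightCell-suc n x)) (sym (leftCell-suc n x))

  -- The names on input sides tell the regions apart: away from the source the seed's tile fits
  -- nowhere, and every other kind fits only in the future, the past, or one half of the strip.
  -- There the inputs fix its parameters and with them its outputs.
  matching : ∀ {s} → View s → ∀ t x → ¬ Source (facing s) t x →
    (∀ k → inputAt (facing s) t x k ≡ true → nameOn s k ≡ nameAt (facing s) t x k) →
    s ≡ schemeAt (facing s) t x
  matching seed-view (+ suc _) x ¬s match with () ← match 0F refl
  matching seed-view (+ 0) (+ suc _) ¬s match with () ← match 2F refl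
  matching seed-view (+ 0) (+ 0) ¬s match = contradiction source-at ¬s
  matching seed-view (+ 0) -[1+ _ ] ¬s match with () ← match 0F refl
  matching seed-view -[1+ _ ] x ¬s match with () ← match 1F refl
  matching leftUp-view (+ suc _) x ¬s match with () ← match 0F refl
  matching leftUp-view (+ 0) (+ suc _) ¬s match with () ← match 2F refl
  matching leftUp-view (+ 0) (+ 0) ¬s match = contradiction source-at ¬s
  matching leftUp-view (+ 0) -[1+ n ] ¬s match = initial-left n
  matching leftUp-view -[1+ _ ] x ¬s match with () ← match 1F refl
  matching fillUp-view (+ suc _) x ¬s match with () ← match 0F refl
  matching fillUp-view (+ 0) (+ suc _) ¬s match with () ← match 2F refl
  matching fillUp-view (+ 0) (+ 0) ¬s match = contradiction source-at ¬s
  matching fillUp-view (+ 0) -[1+ _ ] ¬s match with () ← match 0F refl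
  matching fillUp-view -[1+ _ ] x ¬s match = refl
  matching (rightUp-view s) (+ suc _) x ¬s match with () ← match 0F refl
  matching (rightUp-view s) (+ 0) (+ suc n) ¬s match with refl ← match 2F refl = initial-right n
  matching (rightUp-view s) (+ 0) (+ 0) ¬s match = contradiction source-at ¬s
  matching (rightUp-view s) (+ 0) -[1+ _ ] ¬s match with () ← match 0F refl
  matching (rightUp-view s) -[1+ _ ] x ¬s match with () ← match 1F refl
  matching (meet-view l r) (+ suc _) x ¬s match
    with refl ← match 0F refl | refl ← match 2F refl = refl
  matching (meet-view l r) (+ 0) (+ suc _) ¬s match with () ← match 2F refl
  matching (meet-view l r) (+ 0) (+ 0) ¬s match = contradiction source-at ¬s
  matching (meet-view l r) (+ 0) -[1+ _ ] ¬s match with () ← match 0F refl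
  matching (meet-view l r) -[1+ _ ] x ¬s match with () ← match 1F refl
  matching leftDown-view (+ _) x ¬s match with () ← match 1F refl
  matching leftDown-view -[1+ 0 ] (+ _) ¬s match with () ← match 0F refl
  matching leftDown-view -[1+ 0 ] -[1+ n ] ¬s match = chain-left n
  matching leftDown-view -[1+ suc _ ] x ¬s match with () ← match 0F refl
  matching fillDown-view (+ _) x ¬s match with () ← match 1F refl
  matching fillDown-view -[1+ 0 ] (+ _) ¬s match with () ← match 0F refl
  matching fillDown-view -[1+ 0 ] -[1+ 0 ] ¬s match with () ← match 2F refl
  matching fillDown-view -[1+ 0 ] -[1+ suc _ ] ¬s match with () ← match 2F refl
  matching fillDown-view -[1+ suc _ ] x ¬s match = refl
  matching (rightDown-view s) (+ _) x ¬s match with () ← match 1F refl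
  matching (rightDown-view s) -[1+ 0 ] (+ _) ¬s match with refl ← match 0F refl = refl
  matching (rightDown-view s) -[1+ 0 ] -[1+ 0 ] ¬s match with () ← match 2F refl
  matching (rightDown-view s) -[1+ 0 ] -[1+ suc _ ] ¬s match with () ← match 2F refl
  matching (rightDown-view s) -[1+ suc _ ] x ¬s match with () ← match 0F refl
  matching (react-view l r eq) (+ n) x ¬s match with refl ← match 1F refl = react-run n x eq
  matching (react-view l r eq) -[1+ 0 ] (+ _) ¬s match with () ← match 0F refl
  matching (react-view l r eq) -[1+ 0 ] -[1+ 0 ] ¬s match with () ← match 2F refl
  matching (react-view l r eq) -[1+ 0 ] -[1+ suc _ ] ¬s match with () ← match 2F refl
  matching (react-view l r eq) -[1+ suc _ ] x ¬s match with () ← match 0F refl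

  nameOn-schemeAt : ∀ o t x k → nameOn (schemeAt o t x) k ≡ nameAt o t x k
  nameOn-schemeAt o t x 0F = refl
  nameOn-schemeAt o t x 1F = refl
  nameOn-schemeAt o t x 2F = refl

  input-unique : ∀ {T} c → T ∈ TileSystem.tiles system → orientation T ≡ proj₂ c → c ≢ source →
    (∀ k → input c k ≡ true → glueOn T k ≡ named (name c k)) →
    ∀ k → glueOn T k ≡ named (name c k)
  input-unique ((x , y) , o) T∈ o≡ c≢source match k
    with s , s∈ , refl ← ∈-map⁻ tileOf T∈ with refl ← o≡ =
    trans (tileOf-glue s k) (cong named (trans (cong (λ s → nameOn s k) s≡)
      (nameOn-schemeAt (facing s) (x ℤ.+ y) x k)))
    where
    s≡ : s ≡ schemeAt (facing s) (x ℤ.+ y) x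
    s≡ = matching (view s∈) (x ℤ.+ y) x (λ src → c≢source (source-unique x y src))
      (λ k i → named-injective (trans (sym (tileOf-glue s k)) (match k i)))

  locallyDeterministic : LocallyDeterministic
  locallyDeterministic = record
    { ideal-neighbour = λ c k → cong named (name-neighbour c k)
    ; ideal-positive  = λ c k → subst (0 <_) (sym (named-strength (name c k)))
                                  (force-positive (proj₁ (name c k)))
    ; ideal-seed      = λ k → trans (tileOf-glue seedUp k) (cong named
                          (trans (cong (λ s → nameOn s k) initial-seed)
                                 (nameOn-schemeAt up 0ℤ 0ℤ k)))
    ; flow            = input-flow
    ; source-input    = λ _ → refl
    ; input-weight    = λ { ((x , y) , o) c≢source →
        trans (cong₂ _+_ (cong₂ _+_ (weight-weightAt x y o 0F) (weight-weightAt x y o 1F))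
                         (weight-weightAt x y o 2F))
              (weightAt-total o (x ℤ.+ y) x (λ src → c≢source (source-unique x y src))) }
    ; input-unique    = input-unique }

  open Properties locallyDeterministic

  -- Coverage of the plane and halting

  Gates : Set
  Gates = ∀ t x → ∃[ lr ] (gateIn t (run t) x ≡ just lr)

  -- Blocked gates affect only the down cells at times t ≥ 0; elsewhere the ideal tile is listed
  -- whatever the machine does.
  schemeAt-∈ : Gates → ∀ o t x → ¬ Source o t x → schemeAt o t x ∈ schemes
  schemeAt-∈ gates up (+ suc n) x ¬s = ∈-meet _ _
  schemeAt-∈ gates up (+ 0) (+ suc n) ¬s =
    subst (_∈ schemes) (initial-right n) (∈-rightUp (suffix-tails n))
  schemeAt-∈ gates up (+ 0) (+ 0) ¬s = contradiction source-at ¬s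
  schemeAt-∈ gates up (+ 0) -[1+ n ] ¬s =
    subst (_∈ schemes) (initial-left n) (there (here refl))
  schemeAt-∈ gates up -[1+ _ ] x ¬s = there (there (there (here refl)))
  schemeAt-∈ gates down (+ n) x ¬s with (l , r) , eq ← gates n x =
    subst (_∈ schemes) (trans (cong (reaction _ _) eq) (react-run n x eq)) (∈-react _ _)
  schemeAt-∈ gates down -[1+ 0 ] (+ n) ¬s = ∈-rightDown (suffix-tails n)
  schemeAt-∈ gates down -[1+ 0 ] -[1+ n ] ¬s =
    subst (_∈ schemes) (chain-left n) (there (there (here refl)))
  schemeAt-∈ gates down -[1+ suc _ ] x ¬s = there (there (there (there (here refl))))

  module Filling (em : ExcludedMiddle 0ℓ) (gates : Gates) {P : Assembly} (prod : Produce system P) where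

    -- Cells are addressed by time and `x`, with `y` tied by an equation, so that inductions on time
    -- avoid subtraction and transport.
    Filled : Orientation → ℤ → ℤ → Set
    Filled o t x = ∀ y → x ℤ.+ y ≡ t → Occupied P ((x , y) , o)

    InputsFilled : Orientation → ℤ → ℤ → Set
    InputsFilled o t x = ∀ k → inputAt o t x k ≡ true →
      ∀ y → x ℤ.+ y ≡ t → Occupied P (neighbour ((x , y) , o) k)

    attach : ∀ o t x → ¬ Source o t x → InputsFilled o t x → Filled o t x
    attach o t x ¬s inputs y refl = fill em prod ((x , y) , o)
      (λ e → ¬s (from e)) (∈-map⁺ tileOf (schemeAt-∈ gates o (x ℤ.+ y) x ¬s))
      (λ k i → inputs k i y refl)
      where
      from : ((x , y) , o) ≡ source → Source o (x ℤ.+ y) x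
      from refl = source-at

    below : ∀ {t} x → Filled down (ℤ.pred t) x → ∀ y → x ℤ.+ y ≡ t →
            Occupied P (neighbour ((x , y) , up) 0F)
    below x filled y e = filled (ℤ.pred y) (trans (ℤ.+-pred x y) (cong ℤ.pred e))

    before : ∀ {t} x → Filled down (ℤ.pred t) (ℤ.pred x) → ∀ y → x ℤ.+ y ≡ t →
             Occupied P (neighbour ((x , y) , up) 2F)
    before x filled y e = filled y (trans (ℤ.pred-+ x y) (cong ℤ.pred e))

    above : ∀ {t} x → Filled up (ℤ.suc t) x → ∀ y → x ℤ.+ y ≡ t →
            Occupied P (neighbour ((x , y) , down) 0F)
    above x filled y e = filled (ℤ.suc y) (trans (+-sucʳ x y) (cong ℤ.suc e))

    after : ∀ {t} x → Filled up (ℤ.suc t) (ℤ.suc x) → ∀ y → x ℤ.+ y ≡ t →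
            Occupied P (neighbour ((x , y) , down) 2F)
    after x filled y e = filled y (trans (+-sucˡ x y) (cong ℤ.suc e))

    seed-filled : Filled up (+ 0) (+ 0)
    seed-filled y e = _ , produce-seed prod ,
      cong (λ z → (0ℤ , z) , up) (trans (sym e) (ℤ.+-identityˡ y))

    right-up : ∀ n → Filled up (+ 0) (+ n)
    right-down : ∀ n → Filled down -[1+ 0 ] (+ n)
    right-up zero    = seed-filled
    right-up (suc n) = attach up (+ 0) (+ suc n) (λ ())
      (λ { 2F _ → before (+ suc n) (right-down n) })
    right-down n = attach down -[1+ 0 ] (+ n) (λ ()) (λ { 0F _ → above (+ n) (right-up n) })

    left-up : ∀ n → Filled up (+ 0) -[1+ n ]
    left-down : ∀ n → Filled down -[1+ 0 ] -[1+ n ]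
    left-up n = attach up (+ 0) -[1+ n ] (λ ()) (λ { 0F _ → below -[1+ n ] (left-down n) })
    left-down zero    = attach down -[1+ 0 ] -[1+ 0 ] (λ ()) (λ { 2F _ → after -[1+ 0 ] seed-filled })
    left-down (suc n) = attach down -[1+ 0 ] -[1+ suc n ] (λ ()) (λ { 2F _ → after -[1+ suc n ] (left-up n) })

    future-up : ∀ n x → Filled up (+ n) x
    future-down : ∀ n x → Filled down (+ n) x
    future-up zero (+ n)    = right-up n
    future-up zero -[1+ n ] = left-up n
    future-up (suc n) x = attach up (+ suc n) x (λ ())
      (λ { 0F _ → below x (future-down n x) ; 2F _ → before x (future-down n (ℤ.pred x)) })
    future-down n x = attach down (+ n) x (λ ()) (λ { 1F _ → future-up n x })

    past-down : ∀ n x → Filled down -[1+ n ] x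
    past-up : ∀ n x → Filled up -[1+ n ] x
    past-down zero (+ n)    = right-down n
    past-down zero -[1+ n ] = left-down n
    past-down (suc n) x = attach down -[1+ suc n ] x (λ ())
      (λ { 0F _ → above x (past-up n x) ; 2F _ → after x (past-up n (ℤ.suc x)) })
    past-up n x = attach up -[1+ n ] x (λ ()) (λ { 1F _ → past-down n x })

    filled : ∀ o t x → Filled o t x
    filled up   (+ n)    = future-up n
    filled up   -[1+ n ] = past-up n
    filled down (+ n)    = future-down n
    filled down -[1+ n ] = past-down n

    fullPlane : FullPlane P
    fullPlane = (λ { ((x , y) , o) → filled o (x ℤ.+ y) x y refl }) , produce-bond prod

  -- At height t - x the time is t, so the down tile found there has a `both` name on side 1. Among
  -- down tiles only those of a `react-view` have one, and they exist for open gates only.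
  covered-gates : ∀ {P} → Produce system P → (∀ c → Occupied P c) → Gates
  covered-gates {P} prod covered t x
    with p , Pp , e ← covered ((x , + t ℤ.- x) , down)
    with s , s∈ , tile≡ ← ∈-map⁻ tileOf (produce-tile prod Pp) =
    gated (view s∈) (trans (sym (cong orientation tile≡)) (cong proj₂ e))
      (named-injective (trans (sym (cong (λ T → glueOn T 1F) tile≡))
        (trans (produce-ideal prod Pp 1F) (cong (λ c → named (name c 1F)) e))))
    where
    time : x ℤ.+ (+ t ℤ.- x) ≡ + t
    time = trans (ℤ.+-comm x _) (trans (ℤ.+-assoc (+ t) (ℤ.- x) x)
             (trans (cong (λ z → + t ℤ.+ z) (ℤ.+-inverseˡ x)) (ℤ.+-identityʳ (+ t))))
    gated′ : ∀ {s} → View s → facing s ≡ down → name₁ s ≡ diagonal (+ t) x →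
             ∃[ lr ] (gateIn t (run t) x ≡ just lr)
    gated′ (react-view l r eq) _ refl = _ , eq
    gated : ∀ {s} → View s → facing s ≡ down →
            name₁ s ≡ diagonal (x ℤ.+ (+ t ℤ.- x)) x → ∃[ lr ] (gateIn t (run t) x ≡ just lr)
    gated v o≡ n≡ = gated′ v o≡ (trans n≡ (cong (λ u → diagonal u x) time))

  not-full⇔halts : ExcludedMiddle 0ℓ → ∀ P → Produce system P → (¬ FullPlane P) ⇔ Halts M w
  not-full⇔halts em P prod = mk⇔ to from
    where
    to : ¬ FullPlane P → Halts M w
    to ¬full with em {∃[ t ] (action M (run t) ≡ nothing)}
    ... | yes (t , stuck) = stuck⇒halts t stuck
    ... | no never        = contradiction (Filling.fullPlane em gates prod) ¬full
      where
      gates : Gates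
      gates t x with run-gate t x
      ... | inj₁ gated       = _ , gated
      ... | inj₂ (stuck , _) = contradiction (t , stuck) never
    from : Halts M w → ¬ FullPlane P
    -- The gate holding the head of the halted configuration is blocked, although coverage would
    -- make it open.
    from halts (covered , _) with t , stuck ← halts⇒stuck halts
      with x , blocked ← run-stuck t stuck
      with _ , open′ ← covered-gates prod covered t x
      with () ← trans (sym blocked) open′

theorem1 : (τ : ℕ) → 2 ≤ τ →
    Σ[ system ∈ ((M : TuringMachine) → Word M → TileSystem τ) ]
    (ExcludedMiddle 0ℓ →
    (M : TuringMachine) (w : Word M) →
    Deterministic (system M w) ×
    ((P : Assembly) → Produce (system M w) P →
    (¬ FullPlane P) ⇔ Halts M w))
theorem1 (suc (suc m)) (s≤s (s≤s z≤n)) = Tiling.system m , λ em M w →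
  LocalDeterminism.Properties.deterministic _ _ _ (Tiling.locallyDeterministic m M w) em ,
  Tiling.not-full⇔halts m M w em
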